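{- Let $k\ge1$ and $\pi\in S_k$. (1) If $\pi$ has no peaks, then $g(\pi,n)=\Theta\left((\log n)^{k-1}\right)$ as $n\to\infty$ and $P(\pi,r)=\Theta\left(r(\log r)^{k-1}\right)$ as $r\to\infty$. (2) If $\pi$ has at least one peak, then $g(\pi,n)=O\left((\log n)^{k-2}\right)$ as $n\to\infty$ and $P(\pi,r)=O\left(r(\log r)^{k-2}\right)$ as $r\to\infty$.
   Context: A peak of $\pi\in S_k$ is an index $i$ with $1<i<k$ such that $\pi(i)>\pi(i-1)$ and $\pi(i)>\pi(i+1)$. A $\pi$-wave is an increasing sequence of integers $x_1<\cdots<x_{k+1}$ such that for all $1\le i,j\le k$, $x_{i+1}-x_i > x_{j+1}-x_j$ if and only if $\pi(i)>\pi(j)$. $g(\pi,n)$ is the largest cardinality of a subset of $[n]=\{1,\dots,n\}$ containing no $\pi$-wave. $P(\pi,r)$ is the least positive integer $M$ such that every $r$-coloring of $[M]$ contains a monochromatic $\pi$-wave. Implied constants may depend on $\pi$. -}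

module Defs where

open import Data.Nat as ℕ using (ℕ; zero; suc; _+_; _*_; _∸_; _^_; _≤_; _<_)
open import Data.Nat.Logarithm using (⌊log₂_⌋)
open import Data.Fin as Fin using (Fin; toℕ; inject₁)
open import Data.Fin.Subset using (Subset; _∈_; ∣_∣)
open import Data.Fin.Permutation using (Permutation′; _⟨$⟩ʳ_)
open import Data.Product using (Σ; ∃; _×_)
open import Function.Bundles using (_⇔_)
open import Relation.Binary.PropositionalEquality using (_≡_)
open import Relation.Nullary using (¬_)

-- S_k, permutations of {0,…,k-1} (0-based index i ≙ paper's index i+1)
Perm : ℕ → Set
Perm k = Permutation′ k

HasPeak : ∀ {k} → Perm k → Set
HasPeak {k} π = Σ (Fin k) λ i → Σ (Fin k) λ j → Σ (Fin k) λ l →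
  (suc (toℕ j) ≡ toℕ i) × (suc (toℕ i) ≡ toℕ l) ×
  ((π ⟨$⟩ʳ j) Fin.< (π ⟨$⟩ʳ i)) × ((π ⟨$⟩ʳ l) Fin.< (π ⟨$⟩ʳ i))

gap : ∀ {k} → (Fin (suc k) → ℕ) → Fin k → ℕ
gap x i = x (Fin.suc i) ∸ x (inject₁ i)

IsWave : ∀ {k} → Perm k → (Fin (suc k) → ℕ) → Set
IsWave {k} π x =
  (∀ (i : Fin k) → x (inject₁ i) < x (Fin.suc i)) ×
  (∀ (i j : Fin k) → (gap x j < gap x i) ⇔ ((π ⟨$⟩ʳ j) Fin.< (π ⟨$⟩ʳ i)))

-- [n] = {1,…,n} is represented by Fin n (element t ≙ toℕ t + 1; gaps are
-- translation invariant).  A subset A of [n] contains a π-wave: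
ContainsWave : ∀ {k n} → Perm k → Subset n → Set
ContainsWave {k} {n} π A = Σ (Fin (suc k) → Fin n) λ x →
  IsWave π (λ i → toℕ (x i)) × (∀ i → x i ∈ A)

IsG : ∀ {k} → Perm k → ℕ → ℕ → Set
IsG π n m =
  (Σ (Subset n) λ A → ¬ ContainsWave π A × ∣ A ∣ ≡ m) ×
  (∀ (A : Subset n) → ¬ ContainsWave π A → ∣ A ∣ ≤ m)

HasMonoWave : ∀ {k M r} → Perm k → (Fin M → Fin r) → Set
HasMonoWave {k} {M} π c = Σ (Fin (suc k) → Fin M) λ x →
  IsWave π (λ i → toℕ (x i)) × (∀ i → c (x i) ≡ c (x Fin.zero))

AllColouringsMono : ∀ {k} → Perm k → ℕ → ℕ → Set
AllColouringsMono π r M = ∀ (c : Fin M → Fin r) → HasMonoWave π c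

IsP : ∀ {k} → Perm k → ℕ → ℕ → Set
IsP π r M = (1 ≤ M) × AllColouringsMono π r M ×
  (∀ M′ → 1 ≤ M′ → M′ < M → ¬ AllColouringsMono π r M′)

-- asymptotics (constants are natural numbers; log is ⌊log₂⌋, which is
-- within a constant factor of any real log for n ≥ 2)
-- "every h with R n h satisfies h = O(f n)"
BigO : (ℕ → ℕ → Set) → (ℕ → ℕ) → Set
BigO R f = Σ ℕ λ C → Σ ℕ λ N → ∀ n → N ≤ n → ∀ h → R n h → h ≤ C * f n

BigΩ : (ℕ → ℕ → Set) → (ℕ → ℕ) → Set
BigΩ R f = Σ ℕ λ c → Σ ℕ λ N → ∀ n → N ≤ n → ∀ h → R n h → f n ≤ c * h

BigΘ : (ℕ → ℕ → Set) → (ℕ → ℕ) → Set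
BigΘ R f = BigO R f × BigΩ R f

logPow : ℕ → ℕ → ℕ
logPow e n = ⌊log₂ n ⌋ ^ e

rLogPow : ℕ → ℕ → ℕ
rLogPow e r = r * ⌊log₂ r ⌋ ^ e

module Submission where

-- Upper bounds.  If the largest gap of π is its first or last one, halve the span
-- of the set repeatedly: unless the far half holds a wave for the rest of π, only
-- few points are lost per halving, so such a gap costs one factor log n.  In a
-- permutation without peaks every successive maximum is extreme; the first two
-- points cost nothing.
-- Otherwise some successive maximum is interior, and it has to come for free.
-- Pairing up equal full binary trees that lie side by side gives, by pigeonhole
-- on the scale of their distance, full trees with one more branching scale at the
-- cost of a factor log n; a full tree of depth m contains every pattern of m gaps.
-- Let ranks i and i+1 lie on different sides of the interior maximum.  When the
-- scale of rank i is added, no pigeonhole is applied: trees with all values s of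
-- that scale are kept, which saves one factor log n.  Two of the resulting trees
-- that are far apart yield a wave whose maximum is their distance.  If all of them
-- are close together, two have almost the same top split and different values
-- s < t; the left half of one and the right half of the other then supply s and t
-- as the scales of ranks i and i+1, and the top split is the maximum.
--
-- Lower bounds.  For π without peaks, put a set free of π with its maximum removed
-- and a set free of π side by side at a distance above their diameters.  This
-- gives sets with N ~ (log n)^(k-1) points; after a perturbation that preserves
-- the structure, the points represent all residues modulo N, so translates of the
-- set tile the integers, and colouring by translates is optimal up to a constant.

open import Defs
open import Data.Nat
open import Data.Nat.Properties
open import Data.Nat.DivMod using (_/_; _%_; m≡m%n+[m/n]*n; m%n<n; m<n*o⇒m/o<n)
open import Data.Nat.Logarithm using (⌊log₂_⌋; ⌊log₂⌋-mono-≤; ⌊log₂⌊n/2⌋⌋≡⌊log₂n⌋∸1; ⌊log₂[2^n]⌋≡n)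
open import Data.Nat.Tactic.RingSolver using (solve-∀)
open import Data.Bool using (Bool; true; false)
open import Data.Fin as Fin using (Fin; toℕ; fromℕ<; inject₁)
open import Data.Fin.Properties using (toℕ<n; toℕ-injective; toℕ-fromℕ<)
open import Data.Fin.Permutation using (_⟨$⟩ʳ_; _⟨$⟩ˡ_; inverseʳ; inverseˡ)
open import Data.Fin.Subset using (Subset; inside; outside; ∣_∣) renaming (_∈_ to _∈ₛ_)
open import Data.List as List using (List; []; _∷_; _++_; map)
open import Data.List.Properties using (map-++; map-tabulate; ∷-injective; ++-identityʳ)
open import Data.List.Membership.Propositional using (_∈_)
open import Data.List.Membership.Propositional.Properties
  using (∈-++⁻; ∈-++⁺ˡ; ∈-++⁺ʳ; ∈-map⁺; ∈-map⁻; ∈-∃++; ∈-tabulate⁺; ∈-tabulate⁻)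
open import Data.List.Relation.Unary.Any using (here; there)
open import Data.List.Relation.Unary.All using (All; []; _∷_) renaming (lookup to All-lookup; map to All-map)
open import Data.List.Relation.Unary.AllPairs using (AllPairs; []; _∷_)
import Data.List.Relation.Unary.All.Properties as All
import Data.List.Relation.Unary.AllPairs.Properties as AllPairs
open import Data.Vec as Vec using ([]; _∷_; here; there)
open import Data.Vec.Properties using ([]=⇒lookup; lookup∘tabulate)
open import Data.Product using (∃; Σ; _×_; _,_; proj₁; proj₂; map₂)
open import Data.Sum using (_⊎_; inj₁; inj₂; [_,_]′)
open import Data.Empty using (⊥; ⊥-elim)
open import Function using (_∘_; id)
open import Function.Bundles using (_⇔_; mk⇔; Equivalence)
open import Relation.Binary.Definitions using (tri<; tri≈; tri>)
open import Relation.Binary.PropositionalEquality hiding ([_])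
open import Relation.Nullary

-- Sums, ordered families of intervals, and waves

-- Linear arithmetic in one step: the hypotheses are added up to `a ≤ b`, and the equation, left to
-- the ring solver, says that `y` exceeds `x` by `b` minus `a` plus the slack `δ`.
≤-from-sum : ∀ {a b x y} δ → a ≤ b → x + b + δ ≡ y + a → x ≤ y
≤-from-sum {a} {b} {x} {y} δ a≤b eq = +-cancelʳ-≤ a x y
  (≤-trans (+-monoʳ-≤ x a≤b) (≤-trans (m≤m+n (x + b) δ) (≤-reflexive eq)))

sum< : ℕ → (ℕ → ℕ) → ℕ
sum< zero    c = 0
sum< (suc n) c = sum< n c + c n

sum<-mono-< : ∀ n {c d} → (∀ {i} → i < n → c i ≤ d i) → sum< n c ≤ sum< n d
sum<-mono-< zero    h = z≤n
sum<-mono-< (suc n) h = +-mono-≤ (sum<-mono-< n (h ∘ m≤n⇒m≤1+n)) (h ≤-refl)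

sum<-mono : ∀ n {c d} → (∀ i → c i ≤ d i) → sum< n c ≤ sum< n d
sum<-mono n h = sum<-mono-< n (λ {i} _ → h i)

sum<-+ : ∀ n c d → sum< n (λ i → c i + d i) ≡ sum< n c + sum< n d
sum<-+ zero    c d = refl
sum<-+ (suc n) c d rewrite sum<-+ n c d = interchange (sum< n c) (sum< n d) (c n) (d n)
  where
  interchange : ∀ a b x y → a + b + (x + y) ≡ a + x + (b + y)
  interchange = solve-∀

sum<-0 : ∀ n → sum< n (λ _ → 0) ≡ 0
sum<-0 zero    = refl
sum<-0 (suc n) rewrite sum<-0 n = refl

sum<-* : ∀ n k c → sum< n (λ i → k * c i) ≡ k * sum< n c
sum<-* zero    k c = sym (*-zeroʳ k)
sum<-* (suc n) k c rewrite sum<-* n k c = sym (*-distribˡ-+ k (sum< n c) (c n))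

sum<-const : ∀ n k → sum< n (λ _ → k) ≡ n * k
sum<-const zero    k = refl
sum<-const (suc n) k rewrite sum<-const n k = +-comm (n * k) k

sum<-comm : ∀ n m (c : ℕ → ℕ → ℕ) →
  sum< n (λ i → sum< m (c i)) ≡ sum< m (λ j → sum< n (λ i → c i j))
sum<-comm zero    m c = sym (sum<-0 m)
sum<-comm (suc n) m c rewrite sum<-comm n m c = sym (sum<-+ m (λ j → sum< n (λ i → c i j)) (c n))

δ : ℕ → ℕ → ℕ
δ s t with s ≟ t
... | yes _ = 1
... | no  _ = 0

sum<-δ-≥ : ∀ n {s} → n ≤ s → sum< n (δ s) ≡ 0
sum<-δ-≥ zero    _   = refl
sum<-δ-≥ (suc n) {s} n<s with s ≟ n
... | yes refl = ⊥-elim (1+n≰n n<s)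
... | no  _    = trans (+-identityʳ _) (sum<-δ-≥ n (<⇒≤ n<s))

sum<-δ : ∀ {n s} → s < n → sum< n (δ s) ≡ 1
sum<-δ {suc n} {s} s<1+n with s ≟ n
... | yes refl = cong (_+ 1) (sum<-δ-≥ s ≤-refl)
... | no  s≢n  = trans (+-identityʳ _) (sum<-δ (≤∧≢⇒< (s≤s⁻¹ s<1+n) s≢n))

pigeonhole : ∀ {n y} c → 1 ≤ n → n * y ≤ sum< n c → ∃ λ t → t < n × y ≤ c t
pigeonhole {suc n} {y} c _ h with y ≤? c n
... | yes p = n , ≤-refl , p
pigeonhole {suc zero} {y} c _ h | no ¬p = ⊥-elim (¬p (≤-trans (m≤m+n y 0) h))
pigeonhole {suc (suc n)} {y} c _ h | no ¬p =
  let t , t<n , q = pigeonhole {suc n} {y} c (s≤s z≤n)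
                      (≤-from-sum 0 (+-mono-≤ h (<⇒≤ (≰⇒> ¬p))) (rearrange (suc n * y) (sum< (suc n) c) (c (suc n)) y))
  in t , m≤n⇒m≤1+n t<n , q
  where
  rearrange : ∀ a b x y → a + (b + x + y) + 0 ≡ b + (y + a + x)
  rearrange = solve-∀

-- Disjoint intervals from left to right. Points are the case `a ≡ b` of `Pts`; for a tree, `a` and
-- `b` are its leftmost and rightmost point.
data OL (Q : ℕ → ℕ → Set) : ℕ → Set where
  []   : ∀ {lo} → OL Q lo
  cons : ∀ {lo a b} → lo ≤ a → a ≤ b → Q a b → OL Q (suc b) → OL Q lo

len : ∀ {Q lo} → OL Q lo → ℕ
len []               = 0
len (cons _ _ _ xs) = suc (len xs)

weaken : ∀ {Q lo lo′} → lo ≤ lo′ → OL Q lo′ → OL Q lo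
weaken p []               = []
weaken p (cons q r x xs) = cons (≤-trans p q) r x xs

len-weaken : ∀ {Q lo lo′} (p : lo ≤ lo′) (xs : OL Q lo′) → len (weaken p xs) ≡ len xs
len-weaken p []               = refl
len-weaken p (cons q r x xs) = refl

OL-map : ∀ {Q R lo} → (∀ {a b} → Q a b → R a b) → OL Q lo → OL R lo
OL-map f []               = []
OL-map f (cons p q x xs) = cons p q (f x) (OL-map f xs)

len-OL-map : ∀ {Q R lo} (f : ∀ {a b} → Q a b → R a b) (xs : OL Q lo) → len (OL-map {R = R} f xs) ≡ len xs
len-OL-map f []               = refl
len-OL-map f (cons p q x xs) = cong suc (len-OL-map f xs)

Tagged : ℕ → (ℕ → ℕ → ℕ → Set) → ℕ → ℕ → Set
Tagged n R a b = ∃ λ t → t < n × R t a b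

select : ∀ {n R lo} t → OL (Tagged n R) lo → OL (R t) lo
select t [] = []
select t (cons p q (s , _ , r) xs) with s ≟ t
... | yes refl = cons p q r (select t xs)
... | no  _    = weaken (≤-trans p (m≤n⇒m≤1+n q)) (select t xs)

len-select : ∀ {n R lo a b s} t (p : lo ≤ a) (q : a ≤ b) (s<n : s < n) (r : R s a b) xs →
  δ s t + len (select t xs) ≡ len (select {n} {R} t (cons p q (s , s<n , r) xs))
len-select {s = s} t p q _ r xs with s ≟ t
... | yes refl = refl
... | no  _    = sym (len-weaken _ (select t xs))

sum-select : ∀ {n R lo} (xs : OL (Tagged n R) lo) → len xs ≤ sum< n (λ t → len (select t xs))
sum-select [] = z≤n
sum-select {n} {R} (cons p q (s , s<n , r) xs) = begin
  1 + len xs                                          ≤⟨ +-monoʳ-≤ 1 (sum-select xs) ⟩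
  1 + sum< n (λ t → len (select t xs))                ≡⟨ cong (_+ _) (sum<-δ s<n) ⟨
  sum< n (δ s) + sum< n (λ t → len (select t xs))     ≡⟨ sum<-+ n (δ s) _ ⟨
  sum< n (λ t → δ s t + len (select t xs))            ≤⟨ sum<-mono n (λ t → ≤-reflexive (len-select t p q s<n r xs)) ⟩
  sum< n (λ t → len (select {n} {R} t (cons p q (s , s<n , r) xs))) ∎
  where open ≤-Reasoning

-- Gaps are stored together with their ranks, so that waves can be joined and cut as lists, without
-- reindexing a permutation.
data Path (P : ℕ → Set) : ℕ → List (ℕ × ℕ) → ℕ → Set where
  stop : ∀ {a} → P a → Path P a [] a
  step : ∀ {a b c r g zs} → P a → 1 ≤ g → a + g ≡ c → Path P c zs b → Path P a ((r , g) ∷ zs) b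

-- Only one direction of the equivalence in `IsWave`; the other follows in `rising-gaps`, because
-- the ranks of a permutation are distinct.
Mono : List (ℕ × ℕ) → Set
Mono zs = ∀ {p q} → p ∈ zs → q ∈ zs → proj₁ p < proj₁ q → proj₂ p < proj₂ q

Wave : (ℕ → Set) → List ℕ → Set
Wave P w = ∃ λ a → ∃ λ zs → ∃ λ b → Path P a zs b × map proj₁ zs ≡ w × Mono zs

Path-map : ∀ {P R : ℕ → Set} {a zs b} → (∀ {x} → P x → R x) → Path P a zs b → Path R a zs b
Path-map f (stop p)         = stop (f p)
Path-map f (step p q e ps) = step (f p) q e (Path-map f ps)

path-start : ∀ {P a zs b} → Path P a zs b → P a
path-start (stop p)       = p
path-start (step p _ _ _) = p

path-end : ∀ {P a zs b} → Path P a zs b → P b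
path-end (stop p)        = p
path-end (step _ _ _ ps) = path-end ps

path-≤ : ∀ {P a zs b} → Path P a zs b → a ≤ b
path-≤ (stop _)                         = ≤-refl
path-≤ (step {a} {g = g} _ _ refl ps) = ≤-trans (m≤m+n a g) (path-≤ ps)

path-gap : ∀ {P a zs b z} → Path P a zs b → z ∈ zs → a + proj₂ z ≤ b
path-gap (step _ _ refl ps) (here refl) = path-≤ ps
path-gap (step {a} {g = g} _ _ refl ps) (there i) =
  ≤-trans (+-monoˡ-≤ _ (m≤m+n a g)) (path-gap ps i)

path-join : ∀ {P a b c d g r zs₁ zs₂} → Path P a zs₁ b → 1 ≤ g → b + g ≡ c → Path P c zs₂ d →
  Path P a (zs₁ ++ (r , g) ∷ zs₂) d
path-join (stop p)         h e qs = step p h e qs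
path-join (step p x y ps) h e qs = step p x y (path-join ps h e qs)

∈-insert⁻ : ∀ {A : Set} {p x : A} xs {ys} → p ∈ xs ++ x ∷ ys → p ≡ x ⊎ p ∈ xs ++ ys
∈-insert⁻ [] (here e)        = inj₁ e
∈-insert⁻ [] (there i)       = inj₂ i
∈-insert⁻ (x ∷ xs) (here e)  = inj₂ (here e)
∈-insert⁻ (x ∷ xs) (there i) with ∈-insert⁻ xs i
... | inj₁ e = inj₁ e
... | inj₂ j = inj₂ (there j)

Mono-insert : ∀ {k g} zs₁ {zs₂} → Mono (zs₁ ++ zs₂) →
  (∀ {z} → z ∈ zs₁ ++ zs₂ → proj₁ z < k) → (∀ {z} → z ∈ zs₁ ++ zs₂ → proj₂ z < g) →
  Mono (zs₁ ++ (k , g) ∷ zs₂)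
Mono-insert zs₁ m lab gap i j lt with ∈-insert⁻ zs₁ i | ∈-insert⁻ zs₁ j
... | inj₁ refl | inj₁ refl = ⊥-elim (<-irrefl refl lt)
... | inj₁ refl | inj₂ j′   = ⊥-elim (<-asym lt (lab j′))
... | inj₂ i′   | inj₁ refl = gap i′
... | inj₂ i′   | inj₂ j′   = m i′ j′ lt

label-All : ∀ {Q : ℕ → Set} {zs : List (ℕ × ℕ)} {w} → map proj₁ zs ≡ w → All Q w → ∀ {z} → z ∈ zs → Q (proj₁ z)
label-All refl qs i = All-lookup qs (∈-map⁺ proj₁ i)

Pts : (ℕ → Set) → ℕ → Set
Pts P = OL (λ a b → a ≡ b × P a)

-- `D` stands for the logarithm of the length of the ambient interval, so `e` is the exponent of the
-- logarithm in the bound for `g`.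
Hits : ℕ → List ℕ → Set₁
Hits e w = ∃ λ K → 1 ≤ K × (∀ (P : ℕ → Set) D → 1 ≤ D → (∀ {x} → P x → x < 2 ^ D) →
  (xs : Pts P 0) → K * D ^ e ≤ len xs → Wave P w)

partition : ∀ {P : ℕ → Set} {lo} θ (xs : Pts P lo) →
  Σ (Pts (λ x → P x × x < θ) lo) λ ys → Σ (Pts (λ x → P x × θ ≤ x) lo) λ zs →
  len ys + len zs ≡ len xs
partition θ [] = [] , [] , refl
partition θ (cons {a = a} p q (refl , x) xs) with partition θ xs | a <? θ
... | ys , zs , e | yes a<θ = cons p q (refl , x , a<θ) ys , weaken (≤-trans p (n≤1+n a)) zs ,
        cong suc (trans (cong (len ys +_) (len-weaken _ zs)) e)
... | ys , zs , e | no a≮θ  = weaken (≤-trans p (n≤1+n a)) ys , cons p q (refl , x , ≮⇒≥ a≮θ) zs ,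
        trans (cong (_+ suc (len zs)) (len-weaken _ ys)) (trans (+-suc _ _) (cong suc e))

unsnoc : ∀ {P : ℕ → Set} {lo} (xs : Pts P lo) → 1 ≤ len xs →
  ∃ λ z → P z × lo ≤ z × Σ (Pts (λ x → P x × x < z) lo) λ ys → suc (len ys) ≡ len xs
unsnoc (cons {a = a} p _ (refl , x) []) _ = a , x , p , [] , refl
unsnoc (cons {a = a} p q (refl , x) xs@(cons _ _ _ _)) _ with unsnoc xs (s≤s z≤n)
... | z , pz , a<z , ys , e =
  z , pz , ≤-trans p (<⇒≤ a<z) , cons p q (refl , x , a<z) ys , cong suc e

Pts-map : ∀ {P R : ℕ → Set} {lo} → (∀ {x} → P x → R x) → Pts P lo → Pts R lo
Pts-map f = OL-map (map₂ f)

Pts-≥ : ∀ {P : ℕ → Set} {lo lo′} → lo ≤ lo′ → (xs : Pts P lo′) →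
  Σ (Pts (λ x → P x × lo ≤ x) lo′) λ ys → len ys ≡ len xs
Pts-≥ h []                             = [] , refl
Pts-≥ h (cons {a = a} p q (refl , x) xs) =
  let ys , e = Pts-≥ (≤-trans h (m≤n⇒m≤1+n p)) xs
  in cons p q (refl , x , ≤-trans h p) ys , cong suc e

-- Upper bound: peeling off an extreme maximal gap

peel-count : ∀ {K D L} X → 1 ≤ K → 1 ≤ D → 1 ≤ X → 3 * K * (D * X) ≤ L → 2 + D * (K * X) ≤ L
peel-count {K} {D} X hK hD hX h = ≤-trans
  (≤-from-sum 0 (+-mono-≤ bound bound) (rearrange K D X)) h
  where
  bound : 1 ≤ D * (K * X)
  bound = *-mono-≤ hD (*-mono-≤ hK hX)
  rearrange : ∀ K D X → 2 + D * (K * X) + (D * (K * X) + D * (K * X)) + 0 ≡ 3 * K * (D * X) + (1 + 1)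
  rearrange = solve-∀

1≤pow : ∀ {D} e → 1 ≤ D → 1 ≤ D ^ e
1≤pow {suc D} e _ = >-nonZero⁻¹ (suc D ^ e) {{m^n≢0 (suc D) e}}

peel-rest : ∀ {m ℓ₁ ℓ₂ L} d → ℓ₁ + ℓ₂ ≡ L → ¬ (m ≤ ℓ₂) → 1 + suc d * m ≤ L → 1 + d * m ≤ ℓ₁
peel-rest {m} {ℓ₁} {ℓ₂} d refl ¬p h =
  ≤-from-sum 0 (+-mono-≤ h (<⇒≤ (≰⇒> ¬p))) (rearrange (d * m) m ℓ₁ ℓ₂)
  where
  rearrange : ∀ x m a b → 1 + x + (a + b + m) + 0 ≡ a + (1 + (m + x) + b)
  rearrange = solve-∀

-- The first point `a₀` anchors the largest gap. Among the points at distance less than `2 ^ suc d`,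
-- those at distance at least `2 ^ d` span less than `2 ^ d`, so a wave for `w` among them has gaps
-- shorter than its distance from `a₀`. If they are too few to force such a wave, fewer than `m`
-- points are lost and `d` drops by one.
peelˡ : ∀ {e k w} → All (_< k) w → Hits e w → Hits (suc e) (k ∷ w)
peelˡ {e} {k} {w} w<k (K , 1≤K , hits) = 3 * K , ≤-trans 1≤K (m≤m+n K _) , result
  where
  module _ (P : ℕ → Set) (D : ℕ) (1≤D : 1 ≤ D) (P<2^D : ∀ {x} → P x → x < 2 ^ D) (a₀ : ℕ) (Pa₀ : P a₀) where
    m = K * D ^ e

    Near : ℕ → ℕ → Set
    Near d x = P x × a₀ < x × x < a₀ + 2 ^ d

    prepend : ∀ d → Wave (λ x → Near (suc d) x × a₀ + 2 ^ d ≤ x) w → Wave P (k ∷ w)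
    prepend d (a , zs , b , p , refl , mono) =
      a₀ , (k , a ∸ a₀) ∷ zs , b ,
      step Pa₀ (m<n⇒0<n∸m a₀<a) (m+[n∸m]≡n (<⇒≤ a₀<a)) (Path-map (proj₁ ∘ proj₁) p) , refl ,
      Mono-insert [] mono (label-All refl w<k) short
      where
      a₀<a = proj₁ (proj₂ (proj₁ (path-start p)))
      far  = proj₂ (path-start p)
      b<   = proj₂ (proj₂ (proj₁ (path-end p)))
      short : ∀ {z} → z ∈ zs → proj₂ z < a ∸ a₀
      short {z} i = +-cancelˡ-< a₀ _ _ (+-cancelʳ-< (2 ^ d) _ _ (begin-strict
        a₀ + proj₂ z + 2 ^ d         ≡⟨ swap a₀ (proj₂ z) (2 ^ d) ⟩
        a₀ + 2 ^ d + proj₂ z         ≤⟨ +-monoˡ-≤ _ far ⟩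
        a + proj₂ z                  ≤⟨ path-gap p i ⟩
        b                            <⟨ b< ⟩
        a₀ + 2 ^ suc d               ≡⟨ double a₀ (2 ^ d) ⟩
        a₀ + 2 ^ d + 2 ^ d           ≤⟨ +-monoˡ-≤ _ far ⟩
        a + 2 ^ d                    ≡⟨ cong (_+ 2 ^ d) (m+[n∸m]≡n (<⇒≤ a₀<a)) ⟨
        a₀ + (a ∸ a₀) + 2 ^ d        ∎))
        where
        open ≤-Reasoning
        swap : ∀ x y z → x + y + z ≡ x + z + y
        swap = solve-∀
        double : ∀ x v → x + 2 * v ≡ x + v + v
        double = solve-∀

    go : ∀ d (xs : Pts (Near d) 0) → 1 + d * m ≤ len xs → Wave P (k ∷ w)
    -- No integer lies strictly between `a₀` and `a₀ + 1`; the extra 1 in `1 + d * m` provides a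
    -- point that contradicts this.
    go zero (cons _ _ (_ , _ , lt , gt) _) _ =
      ⊥-elim (<-irrefl refl (<-≤-trans gt (≤-trans (≤-reflexive (+-comm a₀ 1)) lt)))
    go (suc d) xs h with partition (a₀ + 2 ^ d) xs
    ... | ys , zs , eq with m ≤? len zs
    ...   | yes p = prepend d (hits _ D 1≤D (P<2^D ∘ proj₁ ∘ proj₁) zs p)
    ...   | no ¬p = go d (Pts-map forget ys)
                      (≤-trans (peel-rest d eq ¬p h) (≤-reflexive (sym (len-OL-map _ ys))))
      where
      forget : ∀ {x} → Near (suc d) x × x < a₀ + 2 ^ d → Near d x
      forget ((Px , lo , _) , hi) = Px , lo , hi

  result : ∀ P D → 1 ≤ D → (∀ {x} → P x → x < 2 ^ D) → (xs : Pts P 0) → 3 * K * D ^ suc e ≤ len xs → Wave P (k ∷ w)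
  result P D 1≤D P<2^D xs h with peel-count (D ^ e) 1≤K 1≤D (1≤pow e 1≤D) h
  result P D 1≤D P<2^D [] h | ()
  result P D 1≤D P<2^D (cons {a = a₀} _ _ (refl , Pa₀) xs) h | s≤s h′ =
    go P D 1≤D P<2^D a₀ Pa₀ D (weaken z≤n (Pts-map near (proj₁ (Pts-≥ ≤-refl xs))))
      (≤-trans h′ (≤-reflexive (sym (trans (len-weaken z≤n _) (trans (len-OL-map _ _) (proj₂ (Pts-≥ ≤-refl xs)))))))
    where
    near : ∀ {x} → P x × a₀ < x → P x × a₀ < x × x < a₀ + 2 ^ D
    near (Px , lt) = Px , lt , <-≤-trans (P<2^D Px) (m≤n+m (2 ^ D) a₀)

-- Mirror image of `peelˡ`, with the last point `z₀` as the anchor.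
peelʳ : ∀ {e k w} → All (_< k) w → Hits e w → Hits (suc e) (w ++ k ∷ [])
peelʳ {e} {k} {w} w<k (K , 1≤K , hits) = 3 * K , ≤-trans 1≤K (m≤m+n K _) , result
  where
  module _ (P : ℕ → Set) (D : ℕ) (1≤D : 1 ≤ D) (P<2^D : ∀ {x} → P x → x < 2 ^ D) (z₀ : ℕ) (Pz₀ : P z₀) where
    m = K * D ^ e

    Near : ℕ → ℕ → Set
    Near d x = P x × x < z₀ × z₀ < x + 2 ^ d

    append : ∀ d → Wave (λ x → Near (suc d) x × x + 2 ^ d ≤ z₀) w → Wave P (w ++ k ∷ [])
    append d (a , zs , b , p , refl , mono) =
      a , zs ++ (k , z₀ ∸ b) ∷ [] , z₀ ,
      path-join (Path-map (proj₁ ∘ proj₁) p) (m<n⇒0<n∸m b<z₀) (m+[n∸m]≡n (<⇒≤ b<z₀)) (stop Pz₀) ,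
      map-++ proj₁ zs _ ,
      Mono-insert zs (subst Mono (sym (++-identityʳ zs)) mono) (label-All refl w<k ∘ drop) (short ∘ drop)
      where
      drop : ∀ {z : ℕ × ℕ} → z ∈ zs ++ [] → z ∈ zs
      drop = subst (_ ∈_) (++-identityʳ zs)
      b<z₀ = proj₁ (proj₂ (proj₁ (path-end p)))
      far  = proj₂ (path-end p)
      z₀<  = proj₂ (proj₂ (proj₁ (path-start p)))
      short : ∀ {z} → z ∈ zs → proj₂ z < z₀ ∸ b
      short {z} i = +-cancelˡ-< b _ _ (<-≤-trans b+z<z₀ (≤-reflexive (sym (m+[n∸m]≡n (<⇒≤ b<z₀)))))
        where
        b+z<z₀ : b + proj₂ z < z₀
        b+z<z₀ = ≤-from-sum 0 (+-mono-≤ (+-mono-≤ (path-gap p i) z₀<) (+-mono-≤ far far))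
          (eq (proj₂ z) a b z₀ (2 ^ d))
          where
          eq : ∀ z a b z₀ v → 1 + (b + z) + (b + (a + 2 * v) + (z₀ + z₀)) + 0
            ≡ z₀ + (a + z + (1 + z₀) + (b + v + (b + v)))
          eq = solve-∀

    go : ∀ d (xs : Pts (Near d) 0) → 1 + d * m ≤ len xs → Wave P (w ++ k ∷ [])
    go zero (cons {a = a} _ _ (_ , _ , lt , gt) _) _ =
      ⊥-elim (<-irrefl refl (<-≤-trans gt (≤-trans (≤-reflexive (+-comm a 1)) lt)))
    -- The condition `x < suc z₀ ∸ 2 ^ d` amounts to `x + 2 ^ d ≤ z₀`; if `2 ^ d` exceeds `z₀`, the
    -- truncated threshold is 0 and the far part is empty.
    go (suc d) xs h with partition (suc z₀ ∸ 2 ^ d) xs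
    ... | zs , ys , eq with m ≤? len zs
    ...   | yes p = append d (hits _ D 1≤D (P<2^D ∘ proj₁ ∘ proj₁) (Pts-map far zs) (≤-trans p (≤-reflexive (sym (len-OL-map _ zs)))))
      where
      far : ∀ {x} → Near (suc d) x × x < suc z₀ ∸ 2 ^ d → Near (suc d) x × x + 2 ^ d ≤ z₀
      far {x} (n , lt) = n , s≤s⁻¹ (m≤o∸n⇒m+n≤o (suc x) (<⇒≤ (m∸n≢0⇒n<m (m<n⇒n≢0 lt))) lt)
    ...   | no ¬p = go d (Pts-map near ys)
                      (≤-trans (peel-rest d (trans (+-comm (len ys) _) eq) ¬p h) (≤-reflexive (sym (len-OL-map _ ys))))
      where
      near : ∀ {x} → Near (suc d) x × suc z₀ ∸ 2 ^ d ≤ x → Near d x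
      near {x} ((Px , hi , _) , lo) = Px , hi ,
        ≤-trans (m≤n+m∸n (suc z₀) (2 ^ d)) (≤-trans (+-monoʳ-≤ (2 ^ d) lo) (≤-reflexive (+-comm (2 ^ d) x)))

  result : ∀ P D → 1 ≤ D → (∀ {x} → P x → x < 2 ^ D) → (xs : Pts P 0) → 3 * K * D ^ suc e ≤ len xs → Wave P (w ++ k ∷ [])
  result P D 1≤D P<2^D xs h with peel-count (D ^ e) 1≤K 1≤D (1≤pow e 1≤D) h
  ... | h′ with unsnoc xs (≤-trans (s≤s z≤n) h′)
  ...   | z₀ , Pz₀ , _ , ys , e₁ =
    go P D 1≤D P<2^D z₀ Pz₀ D (Pts-map near ys)
      (≤-trans (s≤s⁻¹ (≤-trans h′ (≤-reflexive (sym e₁)))) (≤-reflexive (sym (len-OL-map _ ys))))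
    where
    near : ∀ {x} → P x × x < z₀ → P x × x < z₀ × z₀ < x + 2 ^ D
    near {x} (Px , lt) = Px , lt , <-≤-trans (P<2^D Pz₀) (m≤n+m (2 ^ D) x)

-- Upper bound: full binary trees

-- A full binary tree of points: across a branching of rank j < m all distances
-- lie in [2^(f j), 2^(2 + f j)), and levels three apart keep these ranges disjoint.
data Sh (P : ℕ → Set) : (m : ℕ) (f : ℕ → ℕ) (a b : ℕ) → Set where
  leaf : ∀ {f a} → P a → Sh P 0 f a a
  node : ∀ {m f a b c d} → Sh P m f a b → Sh P m f c d →
    b + 2 ^ f m ≤ c → d < a + 2 ^ (2 + f m) → (∀ {j} → j < m → 3 + f j ≤ f m) → Sh P (suc m) f a d

Sh-≤ : ∀ {P m f a b} → Sh P m f a b → a ≤ b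
Sh-≤ (leaf _)           = ≤-refl
Sh-≤ (node l r sep _ _) = ≤-trans (Sh-≤ l) (≤-trans (≤-trans (m≤m+n _ _) sep) (Sh-≤ r))

Sh-end : ∀ {P m f a b} → Sh P m f a b → P b
Sh-end (leaf p)         = p
Sh-end (node _ r _ _ _) = Sh-end r

Sh-cong : ∀ {P m f g a b} → (∀ {j} → j < m → f j ≡ g j) → Sh P m f a b → Sh P m g a b
Sh-cong e (leaf p) = leaf p
Sh-cong {f = f} {g} {a} e (node {m} {b = b} {c} {d} l r sep wid low) = node
  (Sh-cong (λ h → e (m≤n⇒m≤1+n h)) l) (Sh-cong (λ h → e (m≤n⇒m≤1+n h)) r)
  (subst (λ x → b + 2 ^ x ≤ c) (e ≤-refl) sep)
  (subst (λ x → d < a + 2 ^ (2 + x)) (e ≤-refl) wid)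
  (λ h → subst₂ (λ x y → 3 + x ≤ y) (e (m≤n⇒m≤1+n h)) (e ≤-refl) (low h))

-- The scale of the root split. A leaf gets 0, so that the bounds `top` and `4 * top` on the extent
-- of a tree hold in all cases.
top : ℕ → (ℕ → ℕ) → ℕ
top zero    f = 0
top (suc m) f = 2 ^ f m

Sh-wide : ∀ {P m f a b} → Sh P m f a b → a + top m f ≤ b
Sh-wide (leaf _) = ≤-reflexive (+-identityʳ _)
Sh-wide (node {m} {f} l r sep _ _) = ≤-trans (+-monoˡ-≤ _ (Sh-≤ l)) (≤-trans sep (Sh-≤ r))

Sh-narrow : ∀ {P m f a b} → Sh P m f a b → b ≤ a + 4 * top m f
Sh-narrow (leaf _) = m≤m+n _ _
Sh-narrow (node {m} {f} {a} _ _ _ wid _) =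
  ≤-trans (<⇒≤ wid) (≤-reflexive (quadruple a (2 ^ f m)))
  where
  quadruple : ∀ a v → a + 2 * (2 * v) ≡ a + 4 * v
  quadruple = solve-∀

top-level : ∀ {P m f a b j} → Sh P m f a b → j < m → 2 ^ (3 + f j) ≤ 8 * top m f
top-level {j = j} (node {m} {f} _ _ _ _ low) j<1+m with j ≟ m
... | yes refl = ≤-reflexive (octuple (2 ^ f m))
  where
  octuple : ∀ v → 2 * (2 * (2 * v)) ≡ 8 * v
  octuple = solve-∀
... | no j≢m = ≤-trans (^-monoʳ-≤ 2 (low (≤∧≢⇒< (s≤s⁻¹ j<1+m) j≢m))) (m≤m+n (2 ^ f m) _)

top-≤ : ∀ m f {t} → (∀ {j} → j < m → 3 + f j ≤ t) → 8 * top m f ≤ 2 ^ t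
top-≤ zero    f h = z≤n
top-≤ (suc m) f h = ≤-trans (≤-reflexive (octuple (2 ^ f m))) (^-monoʳ-≤ 2 (h ≤-refl))
  where
  octuple : ∀ v → 8 * v ≡ 2 * (2 * (2 * v))
  octuple = solve-∀

2^-cancel-≤ : ∀ {s t} → 2 ^ s < 2 ^ suc t → s ≤ t
2^-cancel-≤ {s} {t} h with s ≤? t
... | yes p = p
... | no ¬p = ⊥-elim (<-irrefl refl (<-≤-trans h (^-monoʳ-≤ 2 (≰⇒> ¬p))))

dyadic-level : ∀ D {g} → 1 ≤ g → g < 2 ^ D → ∃ λ t → t < D × 2 ^ t ≤ g × g < 2 ^ suc t
dyadic-level zero    h p = ⊥-elim (<-irrefl refl (<-≤-trans p h))
dyadic-level (suc D) {g} h p with 2 ^ D ≤? g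
... | yes q = D , ≤-refl , q , p
... | no ¬q = let t , t<D , r = dyadic-level D h (≰⇒> ¬q) in t , m≤n⇒m≤1+n t<D , r

upd : (ℕ → ℕ) → ℕ → ℕ → ℕ → ℕ
upd f m t j with j ≟ m
... | yes _ = t
... | no  _ = f j

upd-at : ∀ f m t → upd f m t m ≡ t
upd-at f m t with m ≟ m
... | yes _  = refl
... | no m≢m = ⊥-elim (m≢m refl)

upd-off : ∀ f {m j} t → j ≢ m → upd f m t j ≡ f j
upd-off f {m} {j} t j≢m with j ≟ m
... | yes e = ⊥-elim (j≢m e)
... | no _  = refl

-- The new scale `t` is the dyadic level of the distance between the trees. Since that distance is
-- at least `8 * top m f`, all old levels lie three or more below `t`; the two trees then add at
-- most `2 ^ t` to a distance below `2 ^ suc t`, which keeps the whole within `2 ^ (2 + t)`.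
Sh-pair : ∀ {P m f a b c d} D → Sh P m f a b → Sh P m f c d → suc b + 8 * top m f ≤ c → c < 2 ^ D →
  ∃ λ t → t < D × Sh P (suc m) (upd f m t) a d
Sh-pair {P} {m} {f} {a} {b} {c} {d} D l r sep c<2^D
  with dyadic-level D {c ∸ b} (m<n⇒0<n∸m (≤-trans (m≤m+n (suc b) _) sep)) (≤-<-trans (m∸n≤m c b) c<2^D)
... | t , t<D , lo , hi = t , t<D , node (Sh-cong keep l) (Sh-cong keep r)
        (subst (λ x → b + 2 ^ x ≤ c) (sym (upd-at f m t)) (≤-trans (+-monoʳ-≤ b lo) (≤-reflexive b+g≡c)))
        (subst (λ x → d < a + 2 ^ (2 + x)) (sym (upd-at f m t)) wid)
        (λ j<m → subst₂ (λ x y → 3 + x ≤ y) (keep j<m) (sym (upd-at f m t)) (low j<m))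
  where
  b<c = ≤-trans (m≤m+n (suc b) _) sep
  b+g≡c = m+[n∸m]≡n (<⇒≤ b<c)
  keep : ∀ {j} → j < m → f j ≡ upd f m t j
  keep j<m = sym (upd-off f t (<⇒≢ j<m))
  8top≤g : 8 * top m f ≤ c ∸ b
  8top≤g = +-cancelˡ-≤ b _ _ (≤-trans (n≤1+n _) (≤-trans sep (≤-reflexive (sym b+g≡c))))
  low : ∀ {j} → j < m → 3 + f j ≤ t
  low j<m = 2^-cancel-≤ (≤-<-trans (≤-trans (top-level l j<m) 8top≤g) hi)
  wid : d < a + 2 ^ (2 + t)
  wid = ≤-from-sum (2 ^ t)
    (+-mono-≤ (+-mono-≤ (Sh-narrow l) (Sh-narrow r)) (+-mono-≤ (top-≤ m f low) (+-mono-≤ hi (≤-reflexive (sym b+g≡c)))))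
    (eq a b c d (c ∸ b) (top m f) (2 ^ t))
    where
    eq : ∀ a b c d g w v → suc d + (a + 4 * w + (c + 4 * w) + (v + (2 * v + (b + g)))) + v ≡
      a + 2 * (2 * v) + (b + d + (8 * w + (suc g + c)))
    eq = solve-∀

Sh-skip : ∀ {P m f lo} n (xs : OL (Sh P m f) lo) → n < len xs →
  ∃ λ a → ∃ λ b → lo + n * top m f ≤ a × Sh P m f a b × Σ (OL (Sh P m f) (suc b)) λ ys → suc (n + len ys) ≡ len xs
Sh-skip zero (cons p _ x xs) _ = _ , _ , ≤-trans (≤-reflexive (+-identityʳ _)) p , x , xs , refl
Sh-skip {m = m} {f} {lo} (suc n) (cons {a = a′} {b = b′} p _ x xs) (s≤s h) =
  let a , b , q , y , ys , e = Sh-skip n xs h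
  in a , b , ≤-trans (≤-from-sum 1 (+-mono-≤ p (Sh-wide x)) (eq lo a′ b′ (top m f) (n * top m f))) q , y , ys , cong suc e
  where
  eq : ∀ lo a b w v → lo + (w + v) + (a + b) + 1 ≡ suc b + v + (lo + (a + w))
  eq = solve-∀

-- Ten consecutive intervals: the eight inner ones push the outer two so far
-- apart that the level of their distance exceeds every level inside them.
Sh-pairs : ∀ {P m f lo} D → (∀ {x} → P x → x < 2 ^ D) → ∀ j (xs : OL (Sh P m f) lo) → j * 10 ≤ len xs →
  Σ (OL (Tagged D (λ t → Sh P (suc m) (upd f m t))) lo) λ ys → j ≤ len ys
Sh-pairs D bd zero xs h = [] , z≤n
Sh-pairs {P} {m} {f} D bd (suc j) (cons {b = b₁} p q x xs) (s≤s h)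
  with Sh-skip 8 xs (≤-trans (m≤m+n 9 (j * 10)) h)
... | a , b , sep , y , ys , e
  with Sh-pair D x y sep (≤-<-trans (Sh-≤ y) (bd (Sh-end y)))
     | Sh-pairs D bd j ys (+-cancelˡ-≤ 9 _ _ (≤-trans h (≤-reflexive (sym e))))
... | t , t<D , z | zs , g = cons p (Sh-≤ z) (t , t<D , z) zs , s≤s g

-- Chunks of ten cost a factor 10 and a remainder of up to 9 per row.
opaque
  rate : ℕ
  rate = 19

  1≤rate : 1 ≤ rate
  1≤rate = s≤s z≤n

  rate-count : ∀ {n D y S Q} → n ≤ D → 1 ≤ y → rate * D * y ≤ S → S ≤ n * 9 + 10 * Q → D * y ≤ Q
  rate-count {n} {D} {y} {S} {Q} n≤D 1≤y lower upper = *-cancelˡ-≤ 10 (≤-from-sum {x = 10 * (D * y)} {y = 10 * Q} 0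
    (+-mono-≤ lower (+-mono-≤ upper (+-mono-≤ (*-monoˡ-≤ 9 n≤D) (*-monoʳ-≤ (9 * D) 1≤y))))
    (eq n D y S Q))
    where
    eq : ∀ n D y S Q → 10 * (D * y) + (S + (n * 9 + 10 * Q + (D * 9 + 9 * D * y))) + 0 ≡
      10 * Q + (19 * D * y + (S + (n * 9 + 9 * D * 1)))
    eq = solve-∀

div-mod-10 : ∀ n → ∃ λ q → q * 10 ≤ n × n ≤ 9 + 10 * q
div-mod-10 n = n / 10 ,
  ≤-trans (m≤n+m _ (n % 10)) (≤-reflexive (sym (m≡m%n+[m/n]*n n 10))) ,
  ≤-trans (≤-reflexive (m≡m%n+[m/n]*n n 10)) (+-mono-≤ (s≤s⁻¹ (m%n<n n 10)) (≤-reflexive (*-comm (n / 10) 10)))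

grow-sum : ∀ n D y (a q b : ℕ → ℕ) → n ≤ D → 1 ≤ y → rate * D * y ≤ sum< n a → (∀ s → a s ≤ 9 + 10 * q s) → (∀ s → q s ≤ b s) → D * y ≤ sum< n b
grow-sum n D y a q b n≤D 1≤y h aq qb =
  ≤-trans (rate-count {n} {D} {y} {sum< n a} {sum< n q} n≤D 1≤y h quotients) (sum<-mono n qb)
  where
  quotients : sum< n a ≤ n * 9 + 10 * sum< n q
  quotients = ≤-trans (sum<-mono n aq)
                (≤-reflexive (trans (sum<-+ n (λ _ → 9) (λ s → 10 * q s)) (cong₂ _+_ (sum<-const n 9) (sum<-* n 10 q))))

-- All rows receive the same new scale `t`, because the pigeonhole principle is applied to the
-- counts summed over the rows. Rows that agree in a level therefore continue to do so.
grow : ∀ {P m n} D (f : ℕ → ℕ → ℕ) → (∀ {x} → P x → x < 2 ^ D) → 1 ≤ D → n ≤ D →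
  (F : ∀ s → OL (Sh P m (f s)) 0) → ∀ y → 1 ≤ y → rate * D * y ≤ sum< n (λ s → len (F s)) →
  ∃ λ t → Σ (∀ s → OL (Sh P (suc m) (upd (f s) m t)) 0) λ G → y ≤ sum< n (λ s → len (G s))
grow {P} {m} {n} D f bd 1≤D n≤D F y 1≤y h = conclude (pigeonhole {D} {y} count 1≤D enough)
  where
  q : ℕ → ℕ
  q s = proj₁ (div-mod-10 (len (F s)))
  pairs : ∀ s → Σ (OL (Tagged D (λ t → Sh P (suc m) (upd (f s) m t))) 0) λ ys → q s ≤ len ys
  pairs s = Sh-pairs D bd (q s) (F s) (proj₁ (proj₂ (div-mod-10 (len (F s)))))
  T : ∀ s → OL (Tagged D (λ t → Sh P (suc m) (upd (f s) m t))) 0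
  T s = proj₁ (pairs s)
  count : ℕ → ℕ
  count t = sum< n (λ s → len (select t (T s)))
  conclude : (∃ λ t → t < D × y ≤ count t) →
    ∃ λ t → Σ (∀ s → OL (Sh P (suc m) (upd (f s) m t)) 0) λ G → y ≤ sum< n (λ s → len (G s))
  conclude (t , _ , r) = t , (λ s → select t (T s)) , r
  enough : D * y ≤ sum< D count
  enough = ≤-trans
    (grow-sum n D y (λ s → len (F s)) q (λ s → sum< D (λ t → len (select t (T s)))) n≤D 1≤y h
      (λ s → proj₂ (proj₂ (div-mod-10 (len (F s))))) (λ s → ≤-trans (proj₂ (pairs s)) (sum-select (T s))))
    (≤-reflexive (sum<-comm n D (λ s t → len (select t (T s)))))

-- Families of trees indexed by the scale of one rank

Family : (P : ℕ → Set) (m : ℕ) (f : ℕ → ℕ → ℕ) → Set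
Family P m f = ∀ s → OL (Sh P m (f s)) 0

Row : ℕ → (ℕ → ℕ → ℕ) → Set
Row i f = (∀ s → f s i ≡ s) × (∀ s s′ {j} → j ≢ i → f s j ≡ f s′ j)

Row-upd : ∀ {i f m t} → i ≢ m → Row i f → Row i (λ s → upd (f s) m t)
Row-upd {i} {f} {m} {t} i≢m (at , off) =
  (λ s → trans (upd-off (f s) t i≢m) (at s)) , λ s s′ {j} j≢i → same s s′ j j≢i
  where
  same : ∀ s s′ j → j ≢ i → upd (f s) m t j ≡ upd (f s′) m t j
  same s s′ j j≢i with j ≟ m
  ... | yes _ = refl
  ... | no  _ = off s s′ j≢i

total : ∀ {P m} n (f : ℕ → ℕ → ℕ) → Family P m f → ℕ
total n f F = sum< n (λ s → len (F s))

enough-one : ∀ {Y q L} → 1 ≤ Y → rate * Y ≤ L → L ≤ 9 + 10 * q → Y ≤ q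
enough-one {Y} {q} {L} 1≤Y a b = ≤-trans (≤-reflexive (sym (+-identityʳ Y)))
  (rate-count {1} {1} {Y} {L} ≤-refl 1≤Y (≤-trans (≤-reflexive (cong (_* Y) (*-identityʳ rate))) a) b)

module _ {P : ℕ → Set} (D : ℕ) (bd : ∀ {x} → P x → x < 2 ^ D) (1≤D : 1 ≤ D) where

  1≤rate*D*y : ∀ {y} → 1 ≤ y → 1 ≤ rate * D * y
  1≤rate*D*y 1≤y = *-mono-≤ (*-mono-≤ 1≤rate 1≤D) 1≤y

  grow-one : ∀ i y → 1 ≤ y → (xs : Pts P 0) → (rate * D) ^ i * y ≤ len xs →
    ∃ λ f → Σ (OL (Sh P i f) 0) λ ys → y ≤ len ys
  grow-one zero y 1≤y xs h = (λ j → j) , OL-map (λ { (refl , p) → leaf p }) xs ,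
    ≤-trans (≤-reflexive (sym (*-identityˡ y))) (≤-trans h (≤-reflexive (sym (len-OL-map _ xs))))
  grow-one (suc i) y 1≤y xs h = next (grow-one i (rate * D * y) (1≤rate*D*y 1≤y) xs (≤-trans (≤-reflexive regroup) h))
    where
    rearrange : ∀ a b y → b * (a * y) ≡ a * b * y
    rearrange = solve-∀
    regroup : (rate * D) ^ i * (rate * D * y) ≡ (rate * D) ^ suc i * y
    regroup = rearrange (rate * D) ((rate * D) ^ i) y
    next : (∃ λ f → Σ (OL (Sh P i f) 0) λ ys → rate * D * y ≤ len ys) → ∃ λ f → Σ (OL (Sh P (suc i) f) 0) λ ys → y ≤ len ys
    next (f , ys , g) = done (grow {n = 1} D (λ _ → f) bd 1≤D 1≤D (λ _ → ys) y 1≤y g)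
      where
      done : (∃ λ t → Σ (ℕ → OL (Sh P (suc i) (upd f i t)) 0) λ G → y ≤ sum< 1 (λ s → len (G s))) → ∃ λ f → Σ (OL (Sh P (suc i) f) 0) λ ys → y ≤ len ys
      done (t , G , r) = upd f i t , G 0 , r

  Grown : ℕ → ℕ → ℕ → ℕ → Set
  Grown i m n y = ∃ λ g → Σ (Family P m g) λ G → Row i g × y ≤ total n g G

  grow-rows : ∀ {i m n} j (f : ℕ → ℕ → ℕ) (F : Family P m f) → Row i f → i < m → n ≤ D →
    ∀ y → 1 ≤ y → (rate * D) ^ j * y ≤ total n f F → Grown i (j + m) n y
  grow-rows zero f F row i<m n≤D y 1≤y h = f , F , row , ≤-trans (≤-reflexive (sym (*-identityˡ y))) h
  grow-rows {i} {m} {n} (suc j) f F row i<m n≤D y 1≤y h =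
    next (grow-rows j f F row i<m n≤D (rate * D * y) (1≤rate*D*y 1≤y) (≤-trans (≤-reflexive regroup) h))
    where
    rearrange : ∀ a b y → b * (a * y) ≡ a * b * y
    rearrange = solve-∀
    regroup : (rate * D) ^ j * (rate * D * y) ≡ (rate * D) ^ suc j * y
    regroup = rearrange (rate * D) ((rate * D) ^ j) y
    next : Grown i (j + m) n (rate * D * y) → Grown i (suc j + m) n y
    next (g , G , row′ , r) = done (grow {n = n} D g bd 1≤D n≤D G y 1≤y r)
      where
      done : (∃ λ t → Σ (∀ s → OL (Sh P (suc (j + m)) (upd (g s) (j + m) t)) 0) λ H → y ≤ sum< n (λ s → len (H s))) →
        Grown i (suc j + m) n y
      done (t , H , r′) = (λ s → upd (g s) (j + m) t) , H ,
        Row-upd (<⇒≢ (≤-trans i<m (m≤n+m m j))) row′ , r′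

  -- Level `i` is where a factor `D` is saved: the trees are sorted by its scale, and every class is
  -- kept as a row instead of only the largest one. The `i` levels below and the `j` levels above
  -- pay a factor `rate * D` each.
  grow-family : ∀ i j y → 1 ≤ y → (xs : Pts P 0) → (rate * D) ^ i * (rate * ((rate * D) ^ j * y)) ≤ len xs →
    Grown i (j + suc i) D y
  grow-family i j y 1≤y xs h = split (grow-one i (rate * Y) (*-mono-≤ 1≤rate 1≤Y) xs h)
    where
    Y : ℕ
    Y = (rate * D) ^ j * y
    1≤Y : 1 ≤ Y
    1≤Y = *-mono-≤ (1≤pow j (*-mono-≤ 1≤rate 1≤D)) 1≤y
    expand : ∀ {f q} → Y ≤ q → Σ (OL (Tagged D (λ t → Sh P (suc i) (upd f i t))) 0) (λ zs → q ≤ len zs) → Grown i (j + suc i) D y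
    expand {f} Y≤q (zs , q≤) = grow-rows j (upd f i) (λ s → select s zs)
      (upd-at f i , λ s s′ j≢i → trans (upd-off f s j≢i) (sym (upd-off f s′ j≢i)))
      ≤-refl ≤-refl y 1≤y (≤-trans (≤-trans Y≤q q≤) (sum-select zs))
    split : (∃ λ f → Σ (OL (Sh P i f) 0) λ ys → rate * Y ≤ len ys) → Grown i (j + suc i) D y
    split (f , ys , h′) = chunk (div-mod-10 (len ys))
      where
      chunk : (∃ λ q → q * 10 ≤ len ys × len ys ≤ 9 + 10 * q) → Grown i (j + suc i) D y
      chunk (q , lo , hi) = expand (enough-one 1≤Y h′ hi) (Sh-pairs D bd q ys lo)

-- Patterns realised in full trees

AtLevel : ℕ → ℕ → Set
AtLevel s g = 2 ^ s ≤ g × g < 2 ^ (2 + s)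

-- `ι` tells at which branching level a rank is realised. It is `id` when the maximum is the
-- distance of two trees, and `pinch i` when the root split supplies the maximum.
record Realised (P : ℕ → Set) (f ι : ℕ → ℕ) (u : List ℕ) (a b : ℕ) : Set where
  constructor realised
  field
    {start end} : ℕ
    {gaps}      : List (ℕ × ℕ)
    start-≥     : a ≤ start
    end-≤       : end ≤ b
    path        : Path P start gaps end
    labels      : map proj₁ gaps ≡ u
    levels      : ∀ {z} → z ∈ gaps → AtLevel (f (ι (proj₁ z))) (proj₂ z)

Distinct : (ℕ → ℕ) → List ℕ → Set
Distinct ι = AllPairs (λ r r′ → ι r ≢ ι r′)

record SplitAt (ι : ℕ → ℕ) (m : ℕ) (u : List ℕ) : Set where
  constructor split-at
  field
    {u₁ u₂} : List ℕ
    {r}     : ℕ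
    u≡      : u₁ ++ r ∷ u₂ ≡ u
    ιr≡m    : ι r ≡ m
    u₁-dist : Distinct ι u₁
    u₂-dist : Distinct ι u₂
    u₁<m    : All (λ x → ι x < m) u₁
    u₂<m    : All (λ x → ι x < m) u₂

All-++ˡ : ∀ {Q : ℕ → Set} u₁ {u₂} → All Q (u₁ ++ u₂) → All Q u₁
All-++ˡ []       qs       = []
All-++ˡ (x ∷ u₁) (q ∷ qs) = q ∷ All-++ˡ u₁ qs

below-top : ∀ {m x} (ι : ℕ → ℕ) → ι x ≡ m → ∀ {u} → All (λ y → ι x ≢ ι y) u → All (λ y → ι y < suc m) u →
  All (λ y → ι y < m) u
below-top ι refl []       []       = []
below-top ι refl (p ∷ ps) (q ∷ qs) = ≤∧≢⇒< (s≤s⁻¹ q) (p ∘ sym) ∷ below-top ι refl ps qs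

split-top : ∀ ι m u → Distinct ι u → All (λ r → ι r < suc m) u → All (λ r → ι r < m) u ⊎ SplitAt ι m u
split-top ι m [] _ _ = inj₁ []
split-top ι m (x ∷ u) (d ∷ ds) (p ∷ ps) with ι x ≟ m
... | yes e = inj₂ (split-at refl e [] ds [] (below-top ι e d ps))
... | no ne with split-top ι m u ds ps
...   | inj₁ all = inj₁ (≤∧≢⇒< (s≤s⁻¹ p) ne ∷ all)
...   | inj₂ (split-at {u₁} refl e d₁ d₂ p₁ p₂) =
        inj₂ (split-at refl e (All-++ˡ u₁ d ∷ d₁) d₂ (≤∧≢⇒< (s≤s⁻¹ p) ne ∷ p₁) p₂)

-- The letter of the top level is realised by the root split, the letters before it in the left
-- subtree and those after it in the right one. Without such a letter the left subtree suffices.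
realise : ∀ {P m f a b} → Sh P m f a b → (ι : ℕ → ℕ) (u : List ℕ) → Distinct ι u → All (λ r → ι r < m) u →
  Realised P f ι u a b
realise (leaf p) ι [] _ _ = realised ≤-refl ≤-refl (stop p) refl (λ ())
realise (leaf p) ι (x ∷ u) _ (() ∷ _)
realise {P} {f = f} {a} {d} (node {m} {b = b} {c} l r sep wid _) ι u ds ps = join (split-top ι m u ds ps)
  where
  link : ∀ {u₁ x u₂} → ι x ≡ m → Realised P f ι u₁ a b → Realised P f ι u₂ c d → Realised P f ι (u₁ ++ x ∷ u₂) a d
  link {x = x} refl (realised {end = b₁} {gaps₁} a≤ b₁≤b p₁ refl lev₁) (realised {start = a₂} {gaps = gaps₂} c≤a₂ b₂≤d p₂ refl lev₂) =
    realised a≤ b₂≤d (path-join p₁ (m<n⇒0<n∸m b₁<a₂) (m+[n∸m]≡n (<⇒≤ b₁<a₂)) p₂) (map-++ proj₁ gaps₁ _) lev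
    where
    sep′ : b₁ + 2 ^ f m ≤ a₂
    sep′ = ≤-trans (+-monoˡ-≤ _ b₁≤b) (≤-trans sep c≤a₂)
    b₁<a₂ : b₁ < a₂
    b₁<a₂ = ≤-trans (≤-trans (≤-reflexive (+-comm 1 b₁)) (+-monoʳ-≤ b₁ (>-nonZero⁻¹ (2 ^ f m) {{m^n≢0 2 (f m)}}))) sep′
    wid′ : a₂ < b₁ + 2 ^ (2 + f m)
    wid′ = ≤-<-trans (≤-trans (path-≤ p₂) b₂≤d) (<-≤-trans wid (+-monoˡ-≤ _ (≤-trans a≤ (path-≤ p₁))))
    lev : ∀ {z} → z ∈ gaps₁ ++ (x , a₂ ∸ b₁) ∷ gaps₂ → AtLevel (f (ι (proj₁ z))) (proj₂ z)
    lev i with ∈-++⁻ gaps₁ i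
    ... | inj₁ j            = lev₁ j
    ... | inj₂ (there j)    = lev₂ j
    ... | inj₂ (here refl)  =
      +-cancelˡ-≤ b₁ _ _ (≤-trans sep′ (≤-reflexive (sym (m+[n∸m]≡n (<⇒≤ b₁<a₂))))) ,
      +-cancelˡ-< b₁ _ _ (≤-<-trans (≤-reflexive (m+[n∸m]≡n (<⇒≤ b₁<a₂))) wid′)
  join : All (λ r → ι r < m) u ⊎ SplitAt ι m u → Realised P f ι u a d
  join (inj₁ ps′) = left (realise l ι u ds ps′)
    where
    left : Realised P f ι u a b → Realised P f ι u a d
    left (realised a≤ ≤b p e lev) =
      realised a≤ (≤-trans ≤b (≤-trans (≤-trans (m≤m+n _ _) sep) (Sh-≤ r))) p e lev
  join (inj₂ (split-at {u₁} {u₂} refl e d₁ d₂ p₁ p₂)) = link e (realise l ι u₁ d₁ p₁) (realise r ι u₂ d₂ p₂)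

-- Levels two apart make the ranges of `AtLevel` disjoint, so the gaps are ordered like the ranks.
-- Both halves only have to follow one common level function `ℓ` of the ranks; they may come from
-- trees of different rows.
assemble : ∀ {P f g ι u v a b c d K} (ℓ : ℕ → ℕ) → Realised P f ι u a b → Realised P g ι v c d →
  All (_< K) u → All (_< K) v → (∀ {r} → r ∈ u → f (ι r) ≡ ℓ r) → (∀ {r} → r ∈ v → g (ι r) ≡ ℓ r) →
  (∀ {r r′} → r < r′ → r′ < K → 2 + ℓ r ≤ ℓ r′) → b < c → (∀ {r} → r < K → b + 2 ^ (2 + ℓ r) ≤ c) →
  Wave P (u ++ K ∷ v)
assemble {P} {f} {g} {ι} {b = b} {c} {K = K} ℓ (realised {a₁} {b₁} {gaps₁} _ b₁≤b p₁ refl lev₁) (realised {a₂} {b₂} {gaps₂} c≤a₂ _ p₂ refl lev₂)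
  u<K v<K f≡ g≡ ℓ-mono b<c far =
  a₁ , gaps₁ ++ (K , a₂ ∸ b₁) ∷ gaps₂ , b₂ ,
  path-join p₁ (m<n⇒0<n∸m b₁<a₂) (m+[n∸m]≡n (<⇒≤ b₁<a₂)) p₂ ,
  map-++ proj₁ gaps₁ _ ,
  Mono-insert gaps₁ mono lab short
  where
  b₁<a₂ : b₁ < a₂
  b₁<a₂ = ≤-<-trans b₁≤b (<-≤-trans b<c c≤a₂)
  lab : ∀ {z} → z ∈ gaps₁ ++ gaps₂ → proj₁ z < K
  lab i = [ label-All refl u<K , label-All refl v<K ]′ (∈-++⁻ gaps₁ i)
  lev : ∀ {z} → z ∈ gaps₁ ++ gaps₂ → AtLevel (ℓ (proj₁ z)) (proj₂ z)
  lev {z} i with ∈-++⁻ gaps₁ i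
  ... | inj₁ j = subst (λ s → AtLevel s (proj₂ z)) (f≡ (∈-map⁺ proj₁ j)) (lev₁ j)
  ... | inj₂ j = subst (λ s → AtLevel s (proj₂ z)) (g≡ (∈-map⁺ proj₁ j)) (lev₂ j)
  mono : Mono (gaps₁ ++ gaps₂)
  mono i j lt = <-≤-trans (proj₂ (lev i)) (≤-trans (^-monoʳ-≤ 2 (ℓ-mono lt (lab j))) (proj₁ (lev j)))
  short : ∀ {z} → z ∈ gaps₁ ++ gaps₂ → proj₂ z < a₂ ∸ b₁
  short {z} i = +-cancelˡ-< b₁ _ _ (<-≤-trans (+-monoʳ-< b₁ (proj₂ (lev i)))
    (≤-trans (+-monoˡ-≤ _ b₁≤b) (≤-trans (far (lab i)) (≤-trans c≤a₂ (≤-reflexive (sym (m+[n∸m]≡n (<⇒≤ b₁<a₂))))))))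

-- Waves from two trees on either side of the maximum

record Straddle (K i : ℕ) (u v : List ℕ) : Set where
  field
    u-unique : AllPairs _≢_ u
    v-unique : AllPairs _≢_ v
    u<K      : All (_< K) u
    v<K      : All (_< K) v
    disjoint : ∀ {r} → r ∈ u → r ∈ v → ⊥
    sides    : (i ∈ u × suc i ∈ v) ⊎ (i ∈ v × suc i ∈ u)

∈-∉-≢ : ∀ {u v : List ℕ} {r s} → (∀ {r} → r ∈ u → r ∈ v → ⊥) → r ∈ u → s ∈ v → r ≢ s
∈-∉-≢ disj r∈u s∈v refl = disj r∈u s∈v

All-tabulate : ∀ {A : Set} {Q : A → Set} u → (∀ {x} → x ∈ u → Q x) → All Q u
All-tabulate []      h = []
All-tabulate (x ∷ u) h = h (here refl) ∷ All-tabulate u (h ∘ there)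

distinct : ∀ {ι u} → AllPairs _≢_ u → (∀ {r r′} → r ∈ u → r′ ∈ u → r ≢ r′ → ι r ≢ ι r′) → Distinct ι u
distinct []       h = []
distinct (p ∷ ps) h = All-tabulate _ (λ j → h (here refl) (there j) (All-lookup p j)) ∷ distinct ps (λ i j → h (there i) (there j))

Sh-spaced : ∀ {P m f a b j j′} → Sh P m f a b → j < j′ → j′ < m → 3 + f j ≤ f j′
Sh-spaced {j′ = j′} (node {m} l _ _ _ low) j<j′ j′<1+m with j′ ≟ m
... | yes refl = low j<j′
... | no  j′≢m = Sh-spaced l j<j′ (≤∧≢⇒< (s≤s⁻¹ j′<1+m) j′≢m)

-- Rank i takes its level from the tree on its own side; all other levels are common.
far-wave : ∀ {P K i u v s t a b c d} {f : ℕ → ℕ → ℕ} → Straddle K i u v → Row i f →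
  Sh P K (f s) a b → Sh P K (f t) c d → b < c →
  (∀ {r} → r < K → b + 2 ^ (2 + f s r) ≤ c) → (∀ {r} → r < K → b + 2 ^ (2 + f t r) ≤ c) → Wave P (u ++ K ∷ v)
far-wave {P} {K} {i} {u} {v} {s} {t} {a} {b} {c} {d} {f} str (at , off) x y b<c fs ft = by-side sides
  where
  open Straddle str
  on-left : Realised P (f s) id u a b
  on-left = realise x id u (distinct u-unique (λ _ _ ne → ne)) u<K
  on-right : Realised P (f t) id v c d
  on-right = realise y id v (distinct v-unique (λ _ _ ne → ne)) v<K
  weaken-spacing : ∀ {m n} → 3 + m ≤ n → 2 + m ≤ n
  weaken-spacing = ≤-trans (n≤1+n _)
  by-side : (i ∈ u × suc i ∈ v) ⊎ (i ∈ v × suc i ∈ u) → Wave P (u ++ K ∷ v)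
  by-side (inj₁ (i∈u , _)) = assemble (f s) on-left on-right u<K v<K (λ _ → refl)
    (λ r∈v → off t s (∈-∉-≢ disjoint i∈u r∈v ∘ sym)) (λ lt h → weaken-spacing (Sh-spaced x lt h)) b<c fs
  by-side (inj₂ (i∈v , _)) = assemble (f t) on-left on-right u<K v<K (λ r∈u → off s t (∈-∉-≢ disjoint r∈u i∈v))
    (λ _ → refl) (λ lt h → weaken-spacing (Sh-spaced y lt h)) b<c ft

-- Lets the `suc m` ranks below the maximum use the `m` levels under a root split: ranks `i` and
-- `suc i` share level `i`, and later ranks move down by one. The shared level causes no collision,
-- as the two ranks are realised in different trees.
pinch : ℕ → ℕ → ℕ
pinch i r with r ≤? i
... | yes _ = r
... | no  _ = pred r

pinch-suc : ∀ i → pinch i (suc i) ≡ i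
pinch-suc i with suc i ≤? i
... | yes h = ⊥-elim (1+n≰n h)
... | no  _ = refl

pinch-id : ∀ i → pinch i i ≡ i
pinch-id i with i ≤? i
... | yes _ = refl
... | no h  = ⊥-elim (h ≤-refl)

pinch-mono : ∀ {i r r′} → r < r′ → ¬ (r ≡ i × r′ ≡ suc i) → pinch i r < pinch i r′
pinch-mono {i} {r} {r′} lt ne with r ≤? i | r′ ≤? i
... | yes _ | yes _ = lt
... | no h  | yes g = ⊥-elim (h (≤-trans (<⇒≤ lt) g))
pinch-mono {i} {suc r} {suc r′} (s≤s lt) ne | no _ | no _ = lt
pinch-mono {i} {zero} {suc r′} lt ne | no h | no _ = ⊥-elim (h z≤n)
pinch-mono {i} {r} {suc r′} (s≤s r≤r′) ne | yes h | no g with r ≟ r′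
... | no r≢r′ = ≤∧≢⇒< r≤r′ r≢r′
... | yes refl = ⊥-elim (ne (≤-antisym h (s≤s⁻¹ (≰⇒> g)) , cong suc (≤-antisym h (s≤s⁻¹ (≰⇒> g)))))

pinch-≢ : ∀ {i r} → r ≢ i → r ≢ suc i → pinch i r ≢ i
pinch-≢ {i} {r} r≢i r≢1+i with <-cmp r i
... | tri< lt _ _ = <⇒≢ (subst (pinch i r <_) (pinch-id i) (pinch-mono lt (<⇒≢ lt ∘ proj₁)))
... | tri≈ _ e _ = ⊥-elim (r≢i e)
... | tri> _ _ gt = ≢-sym (<⇒≢ (subst (_< pinch i r) (pinch-id i) (pinch-mono gt (r≢1+i ∘ proj₂))))

pinch-< : ∀ {i r m} → i < m → r < suc m → pinch i r < m
pinch-< {i} {r} i<m r≤m with r ≤? i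
... | yes h = ≤-<-trans h i<m
pinch-< {i} {zero} i<m r≤m | no h = ⊥-elim (h z≤n)
pinch-< {i} {suc r} i<m r≤m | no h = s≤s⁻¹ r≤m

pinch-inj : ∀ {i r r′} → r ≢ r′ → ¬ (r ≡ i × r′ ≡ suc i) → ¬ (r′ ≡ i × r ≡ suc i) → pinch i r ≢ pinch i r′
pinch-inj {i} {r} {r′} ne h h′ with <-cmp r r′
... | tri< lt _ _ = <⇒≢ (pinch-mono lt h)
... | tri≈ _ e _  = ⊥-elim (ne e)
... | tri> _ _ gt = ≢-sym (<⇒≢ (pinch-mono gt h′))

-- Both trees have the levels of the other ranks in common; the ranks i and i+1
-- receive the two different levels s and t, each realised on its own side.
near-wave : ∀ {P m i u v s t lo hi a b c d} {f : ℕ → ℕ → ℕ} → Straddle (suc m) i u v → Row i f → i < m →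
  (i ∈ u × suc i ∈ v × lo ≡ s × hi ≡ t) ⊎ (i ∈ v × suc i ∈ u × lo ≡ t × hi ≡ s) → 3 + lo ≤ hi →
  Sh P m (f s) a b → Sh P m (f t) c d → b < c →
  (∀ {r} → r < m → b + 2 ^ (2 + f s r) ≤ c) → (∀ {r} → r < m → b + 2 ^ (2 + f t r) ≤ c) →
  Wave P (u ++ suc m ∷ v)
near-wave {P} {m} {i} {u} {v} {s} {t} {lo} {hi} {a} {b} {c} {d} {f} str (at , off) i<m side lo<hi x y b<c fs ft = by-side side
  where
  open Straddle str
  not-both : ∀ {w r r′} → (i ∈ w → suc i ∈ w → ⊥) → r ∈ w → r′ ∈ w → ¬ (r ≡ i × r′ ≡ suc i)
  not-both h p q (refl , refl) = h p q
  left-ok : i ∈ u → suc i ∈ u → ⊥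
  left-ok p q = [ (λ z → disjoint q (proj₁ (proj₂ z))) , (λ z → disjoint p (proj₁ z)) ]′ side
  right-ok : i ∈ v → suc i ∈ v → ⊥
  right-ok p q = [ (λ z → disjoint (proj₁ z) p) , (λ z → disjoint (proj₁ (proj₂ z)) q) ]′ side
  on-left : Realised P (f s) (pinch i) u a b
  on-left = realise x (pinch i) u (distinct u-unique (λ p q ne → pinch-inj ne (not-both left-ok p q) (not-both left-ok q p)))
    (All-map (pinch-< i<m) u<K)
  on-right : Realised P (f t) (pinch i) v c d
  on-right = realise y (pinch i) v (distinct v-unique (λ p q ne → pinch-inj ne (not-both right-ok p q) (not-both right-ok q p)))
    (All-map (pinch-< i<m) v<K)
  -- Row `lo` has the scale `lo` at level `i`, which serves rank `i`; rank `suc i` needs the scale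
  -- `hi` of the other row.
  level : ℕ → ℕ
  level r with r ≟ suc i
  ... | yes _ = hi
  ... | no  _ = f lo (pinch i r)
  level-lo : ∀ {r} → r ≢ suc i → f lo (pinch i r) ≡ level r
  level-lo {r} ne with r ≟ suc i
  ... | yes e = ⊥-elim (ne e)
  ... | no  _ = refl
  level-hi : ∀ {r} → r ≢ i → f hi (pinch i r) ≡ level r
  level-hi {r} ne with r ≟ suc i
  ... | yes refl = trans (cong (f hi) (pinch-suc i)) (at hi)
  ... | no  ne′  = off hi lo (pinch-≢ ne ne′)
  mono : (∀ {j j′} → j < j′ → j′ < m → 3 + f lo j ≤ f lo j′) → (∀ {j j′} → j < j′ → j′ < m → 3 + f hi j ≤ f hi j′) →
    ∀ {r r′} → r < r′ → r′ < suc m → 2 + level r ≤ level r′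
  mono lo-sp hi-sp {r} {r′} lt h = ≤-trans (n≤1+n _) (cases (r ≟ i) (r′ ≟ i) (r ≟ suc i) (r′ ≟ suc i))
    where
    via : ∀ {g} → (∀ {j j′} → j < j′ → j′ < m → 3 + f g j ≤ f g j′) → ¬ (r ≡ i × r′ ≡ suc i) →
      f g (pinch i r) ≡ level r → f g (pinch i r′) ≡ level r′ → 3 + level r ≤ level r′
    via sp nb e e′ = subst₂ (λ p q → 3 + p ≤ q) e e′ (sp (pinch-mono lt nb) (pinch-< i<m h))
    -- Two ranks other than `suc i` are compared within row `lo`, two ranks other than `i` within
    -- row `hi`; only the pair `i`, `suc i` relies on `3 + lo ≤ hi`.
    cases : Dec (r ≡ i) → Dec (r′ ≡ i) → Dec (r ≡ suc i) → Dec (r′ ≡ suc i) → 3 + level r ≤ level r′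
    cases (yes refl) _ _ (yes refl) = subst₂ (λ p q → 3 + p ≤ q)
      (trans (sym (trans (cong (f lo) (pinch-id r)) (at lo))) (level-lo (<⇒≢ lt)))
      (trans (sym (trans (cong (f hi) (pinch-suc r)) (at hi))) (level-hi (≢-sym (<⇒≢ lt)))) lo<hi
    cases _ _ (no p) (no q) = via lo-sp (q ∘ proj₂) (level-lo p) (level-lo q)
    cases (no p) (no q) _ _ = via hi-sp (p ∘ proj₁) (level-hi p) (level-hi q)
    cases _ (yes refl) (yes refl) _ = ⊥-elim (<-asym lt ≤-refl)
    cases (yes refl) _ (yes e) _ = ⊥-elim (<⇒≢ ≤-refl e)
    cases _ (yes refl) _ (yes e) = ⊥-elim (<⇒≢ ≤-refl e)
  build : (ℓ≡s : ∀ {r} → r ∈ u → f s (pinch i r) ≡ level r) → (∀ {r} → r ∈ v → f t (pinch i r) ≡ level r) →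
    (∀ {r} → r < suc m → b + 2 ^ (2 + level r) ≤ c) →
    (∀ {r r′} → r < r′ → r′ < suc m → 2 + level r ≤ level r′) → Wave P (u ++ suc m ∷ v)
  build e e′ big sp = assemble level on-left on-right u<K v<K e e′ sp b<c big
  far : (∀ {r} → r < m → b + 2 ^ (2 + f lo r) ≤ c) → (∀ {r} → r < m → b + 2 ^ (2 + f hi r) ≤ c) →
    ∀ {r} → r < suc m → b + 2 ^ (2 + level r) ≤ c
  far flo fhi {r} h with r ≟ i
  ... | no ne    = subst (λ z → b + 2 ^ (2 + z) ≤ c) (level-hi ne) (fhi (pinch-< i<m h))
  ... | yes refl = subst (λ z → b + 2 ^ (2 + z) ≤ c) (level-lo (<⇒≢ ≤-refl)) (flo (pinch-< i<m h))
  by-side : (i ∈ u × suc i ∈ v × lo ≡ s × hi ≡ t) ⊎ (i ∈ v × suc i ∈ u × lo ≡ t × hi ≡ s) → Wave P (u ++ suc m ∷ v)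
  by-side (inj₁ (p , q , refl , refl)) = build (λ r∈u → level-lo (∈-∉-≢ disjoint r∈u q))
    (λ r∈v → level-hi (≢-sym (∈-∉-≢ disjoint p r∈v))) (far fs ft) (mono (Sh-spaced x) (Sh-spaced y))
  by-side (inj₂ (p , q , refl , refl)) = build (λ r∈u → level-hi (∈-∉-≢ disjoint r∈u p))
    (λ r∈v → level-lo (≢-sym (∈-∉-≢ disjoint q r∈v))) (far ft fs) (mono (Sh-spaced y) (Sh-spaced x))

-- Trees of different rows with almost the same root split

last-row : ∀ {n y} c → (∀ s → c s ≤ 1) → suc y ≤ sum< n c → ∃ λ s → s < n × 1 ≤ c s × y ≤ sum< s c
last-row {suc n} {y} c c≤1 h with 1 ≤? c n
... | yes p = n , ≤-refl , p , s≤s⁻¹ (≤-trans h (≤-trans (+-monoʳ-≤ _ (c≤1 n)) (≤-reflexive (+-comm _ 1))))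
... | no ¬p with last-row {n} {y} c c≤1 (≤-trans h (≤-reflexive (trans (cong (sum< n c +_) (n<1⇒n≡0 (≰⇒> ¬p))) (+-identityʳ _))))
...   | s , s<n , q , r = s , m≤n⇒m≤1+n s<n , q , r

nonzero-row : ∀ {n} c → 1 ≤ sum< n c → ∃ λ s → 1 ≤ c s
nonzero-row {suc n} c h with 1 ≤? c n
... | yes p = n , p
... | no ¬p = nonzero-row {n} c (≤-trans h (≤-reflexive (trans (cong (sum< n c +_) (n<1⇒n≡0 (≰⇒> ¬p))) (+-identityʳ _))))

-- `near-wave` asks for two scales that differ by at least 3; the first and the last of four
-- distinct rows do.
spread-rows : ∀ {n} c → (∀ s → c s ≤ 1) → 4 ≤ sum< n c → ∃ λ s → ∃ λ t → 3 + s ≤ t × t < n × 1 ≤ c s × 1 ≤ c t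
spread-rows {n} c c≤1 h with last-row {n} c c≤1 h
... | s₄ , s₄<n , p₄ , h₄ with last-row {s₄} c c≤1 h₄
...   | s₃ , s₃<s₄ , _ , h₃ with last-row {s₃} c c≤1 h₃
...     | s₂ , s₂<s₃ , _ , h₂ with last-row {s₂} c c≤1 h₂
...       | s₁ , s₁<s₂ , p₁ , _ = s₁ , s₄ , ≤-trans (s≤s (≤-trans (s≤s s₁<s₂) s₂<s₃)) s₃<s₄ , s₄<n , p₁ , p₄

first : ∀ {Q lo} (xs : OL Q lo) → 1 ≤ len xs → ∃ λ a → ∃ λ b → Q a b
first (cons _ _ x _) _ = _ , _ , x

cell : ∀ n v {x y} → x ≤ y → y < x + n * v → ∃ λ t → t < n × x + t * v ≤ y × y < x + suc t * v
cell zero v x≤y y< = ⊥-elim (<-irrefl refl (<-≤-trans y< (≤-trans (≤-reflexive (+-identityʳ _)) x≤y)))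
cell (suc n) v {x} {y} x≤y y< with x + n * v ≤? y
... | yes p = n , ≤-refl , p , y<
... | no ¬p with cell n v x≤y (≰⇒> ¬p)
...   | t , t<n , r = t , m≤n⇒m≤1+n t<n , r

rows : ∀ {A : Set} {B : ℕ → Set} n → (∀ s → A ⊎ B s) → A ⊎ (∀ {s} → s < n → B s)
rows zero h = inj₂ λ ()
rows {A} {B} (suc n) h = both (rows n h) (h n)
  where
  both : A ⊎ (∀ {s} → s < n → B s) → A ⊎ B n → A ⊎ (∀ {s} → s < suc n → B s)
  both (inj₁ a) _ = inj₁ a
  both (inj₂ f) (inj₁ a) = inj₁ a
  both (inj₂ f) (inj₂ b) = inj₂ g
    where
    g : ∀ {s} → s < suc n → B s
    g {s} h with s ≟ n
    ... | yes refl = b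
    ... | no ne    = f (≤∧≢⇒< (s≤s⁻¹ h) ne)

module _ {P : ℕ → Set} {m i : ℕ} {u v : List ℕ} {f : ℕ → ℕ → ℕ} (str : Straddle (suc m) i u v) (row : Row i f) (i<m : i < m) where

  V : ℕ
  V = 2 ^ f 0 m

  top≡V : ∀ s → top (suc m) (f s) ≡ V
  top≡V s = cong (2 ^_) (proj₂ row s 0 (≢-sym (<⇒≢ i<m)))

  -- A cell locates the end `b` of the left half of a tree to within half of `V`. Everything is
  -- doubled to avoid halves, and `16 * V` is added to avoid negative differences from `a₀`.
  record Cell (a₀ s t a d : ℕ) : Set where
    constructor in-cell
    field
      {b c} : ℕ
      left  : Sh P m (f s) a b
      right : Sh P m (f s) c d
      apart : b + V ≤ c
      ≥cell : a₀ + a₀ + t * V ≤ b + b + 16 * V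
      <cell : b + b + 16 * V < a₀ + a₀ + suc t * V
      low   : ∀ {r} → r < m → 2 ^ (3 + f s r) ≤ V

  level-≤-V : ∀ {s a b r} → Sh P (suc m) (f s) a b → r < suc m → 2 ^ (2 + f s r) ≤ 4 * V
  level-≤-V {s} {a} {b} {r} x h = *-cancelˡ-≤ 2 (≤-trans (top-level x h) (≤-reflexive (trans (cong (8 *_) (top≡V s)) (eq V))))
    where
    eq : ∀ v → 8 * v ≡ 2 * (4 * v)
    eq = solve-∀

  -- A distance above `4 * V` exceeds all gaps realised inside the trees, even those at the level of
  -- the root splits.
  far-pair : ∀ {s t a b c d} → Sh P (suc m) (f s) a b → Sh P (suc m) (f t) c d → b + 4 * V < c → Wave P (u ++ suc m ∷ v)
  far-pair {b = b} x y h = far-wave str row x y (≤-<-trans (m≤m+n b _) h)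
    (λ r → ≤-trans (+-monoʳ-≤ b (level-≤-V x r)) (<⇒≤ h)) (λ r → ≤-trans (+-monoʳ-≤ b (level-≤-V y r)) (<⇒≤ h))

  near : ∀ {s a₀ d₀ a d} → d₀ ≤ a₀ + 4 * V → Sh P (suc m) (f s) a d → a ≤ d₀ + 4 * V → a₀ ≤ d + 4 * V →
    Tagged 41 (Cell a₀ s) a d
  near {s} {a₀} {d₀} {a} {d} wid₀ x@(node {b = b} {c} l r sep wid low) a≤ a₀≤ = place (cell 41 V above below)
    where
    d≤ : d ≤ a + 4 * V
    d≤ = ≤-trans (Sh-narrow x) (≤-reflexive (cong (λ z → a + 4 * z) (top≡V s)))
    b≤d : b ≤ d
    b≤d = ≤-trans (≤-trans (m≤m+n b _) sep) (Sh-≤ r)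
    above : a₀ + a₀ ≤ b + b + 16 * V
    above = ≤-from-sum 0 (+-mono-≤ (+-mono-≤ half half) (+-mono-≤ (Sh-≤ l) (Sh-≤ l))) (eq a₀ a b V)
      where
      half : a₀ ≤ a + 8 * V
      half = ≤-from-sum 0 (+-mono-≤ a₀≤ d≤) (eq a₀ a d V)
        where
        eq : ∀ a₀ a d V → a₀ + (d + 4 * V + (a + 4 * V)) + 0 ≡ a + 8 * V + (a₀ + d)
        eq = solve-∀
      eq : ∀ a₀ a b V → a₀ + a₀ + (a + 8 * V + (a + 8 * V) + (b + b)) + 0 ≡ b + b + 16 * V + (a₀ + a₀ + (a + a))
      eq = solve-∀
    -- A tree that is not far from the reference tree has `b` at most `8 * V` before and at most
    -- `12 * V` after `a₀`. Doubled and shifted, this is a range of `40 * V` with both ends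
    -- included, hence 41 cells.
    below : b + b + 16 * V < a₀ + a₀ + 41 * V
    below = ≤-from-sum 0 (+-mono-≤ (+-mono-≤ half half) (>-nonZero⁻¹ V {{m^n≢0 2 (f 0 m)}})) (eq a₀ b V)
      where
      half : b ≤ a₀ + 12 * V
      half = ≤-from-sum 0 (+-mono-≤ (+-mono-≤ wid₀ b≤d) (+-mono-≤ a≤ d≤)) (eq a₀ d₀ a b d V)
        where
        eq : ∀ a₀ d₀ a b d V → b + (a₀ + 4 * V + d + (d₀ + 4 * V + (a + 4 * V))) + 0 ≡ a₀ + 12 * V + (d₀ + b + (a + d))
        eq = solve-∀
      eq : ∀ a₀ b V → suc (b + b + 16 * V) + (a₀ + 12 * V + (a₀ + 12 * V) + V) + 0 ≡ a₀ + a₀ + 41 * V + (b + b + 1)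
      eq = solve-∀
    place : (∃ λ t → t < 41 × a₀ + a₀ + t * V ≤ b + b + 16 * V × b + b + 16 * V < a₀ + a₀ + suc t * V) → Tagged 41 (Cell a₀ s) a d
    place (t , t< , lo , hi) = t , t< , in-cell l r (≤-trans (≤-reflexive (cong (b +_) (sym (top≡V s)))) sep) lo hi
      (λ h → ≤-trans (^-monoʳ-≤ 2 (low h)) (≤-reflexive (top≡V s)))

  -- Between the ends of the left halves of two disjoint trees lies a root split of at least `V`,
  -- twice what a cell allows.
  one-per-cell : ∀ {a₀ s t lo} (xs : OL (Cell a₀ s t) lo) → len xs ≤ 1
  one-per-cell [] = z≤n
  one-per-cell (cons _ _ _ []) = ≤-refl
  one-per-cell {a₀} {s} {t} (cons {b = d₁} _ _ x (cons {a = a₂} d₁<a₂ _ y _)) = ⊥-elim (<-irrefl refl contra)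
    where
    module X = Cell x
    module Y = Cell y
    b₁+V<b₂ : X.b + V < Y.b
    b₁+V<b₂ = <-≤-trans (≤-<-trans (≤-trans X.apart (Sh-≤ X.right)) d₁<a₂) (Sh-≤ Y.left)
    contra : V < V
    contra = ≤-from-sum (V + 2) (+-mono-≤ (+-mono-≤ b₁+V<b₂ b₁+V<b₂) (+-mono-≤ X.≥cell Y.<cell))
      (eq X.b Y.b V a₀ (t * V))
      where
      eq : ∀ b b′ V a₀ x → suc V + (b′ + b′ + (b + b + 16 * V + (a₀ + a₀ + (V + x)))) + (V + 2) ≡
        V + (suc (b + V) + suc (b + V) + (a₀ + a₀ + x + suc (b′ + b′ + 16 * V)))
      eq = solve-∀

  -- Within a cell `b` varies by less than half of `V`, while the root split of `y` is at least `V`;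
  -- more than half of `V` remains when the left half is taken from `x`.
  doubled-gap : ∀ {a₀ s s′ t a d a′ d′} (x : Cell a₀ s t a d) (y : Cell a₀ s′ t a′ d′) {g : ℕ} → 2 * g ≤ V →
    Cell.b x + g ≤ Cell.c y
  doubled-gap {a₀} {t = t} x y {g} 2g≤V = *-cancelˡ-≤ 2 (≤-from-sum 1
    (+-mono-≤ (+-mono-≤ X.<cell Y.≥cell) (+-mono-≤ (+-mono-≤ Y.apart Y.apart) 2g≤V))
    (eq X.b Y.b Y.c V a₀ (t * V) g))
    where
    module X = Cell x
    module Y = Cell y
    eq : ∀ b b′ c V a₀ x g → 2 * (b + g) + (a₀ + a₀ + (V + x) + (b′ + b′ + 16 * V) + (c + c + V)) + 1 ≡
      2 * c + (suc (b + b + 16 * V) + (a₀ + a₀ + x) + (b′ + V + (b′ + V) + 2 * g))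
    eq = solve-∀

  -- The left half comes from the row with the smaller scale if `i` stands left of the maximum, and
  -- from the other row otherwise; so rank `i` always receives the smaller scale.
  same-cell : ∀ {a₀ t s s′ a d a′ d′} → 3 + s ≤ s′ → Cell a₀ s t a d → Cell a₀ s′ t a′ d′ → Wave P (u ++ suc m ∷ v)
  same-cell {a₀} {t} {s} {s′} lt x y = by-side (Straddle.sides str)
    where
    combine : ∀ {p q lo hi a d a′ d′} (x : Cell a₀ p t a d) (y : Cell a₀ q t a′ d′) →
      (i ∈ u × suc i ∈ v × lo ≡ p × hi ≡ q) ⊎ (i ∈ v × suc i ∈ u × lo ≡ q × hi ≡ p) → 3 + lo ≤ hi → Wave P (u ++ suc m ∷ v)
    combine x y side lo<hi = near-wave str row i<m side lo<hi (Cell.left x) (Cell.right y)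
      (<-≤-trans (m<m+n _ (>-nonZero⁻¹ _ {{m^n≢0 2 (2 + f _ i)}})) (doubled-gap x y (Cell.low x i<m)))
      (λ h → doubled-gap x y (Cell.low x h)) (λ h → doubled-gap x y (Cell.low y h))
    by-side : (i ∈ u × suc i ∈ v) ⊎ (i ∈ v × suc i ∈ u) → Wave P (u ++ suc m ∷ v)
    by-side (inj₁ (p , q)) = combine x y (inj₁ (p , q , refl , refl)) lt
    by-side (inj₂ (p , q)) = combine y x (inj₂ (p , q , refl , refl)) lt

  search : ∀ {s₀ a₀ d₀} → Sh P (suc m) (f s₀) a₀ d₀ → ∀ s {lo} (xs : OL (Sh P (suc m) (f s)) lo) →
    Wave P (u ++ suc m ∷ v) ⊎ Σ (OL (Tagged 41 (Cell a₀ s)) lo) λ ys → len xs ≤ len ys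
  search {s₀} {a₀} {d₀} x₀ s [] = inj₂ ([] , z≤n)
  search {s₀} {a₀} {d₀} x₀ s {lo} (cons {a = a} {d} p q x xs) = decide (d₀ + 4 * V <? a) (d + 4 * V <? a₀) (search x₀ s xs)
    where
    Answer : ∀ {lo} → OL (Sh P (suc m) (f s)) lo → Set
    Answer {lo} zs = Wave P (u ++ suc m ∷ v) ⊎ Σ (OL (Tagged 41 (Cell a₀ s)) lo) λ ys → len zs ≤ len ys
    decide : Dec (d₀ + 4 * V < a) → Dec (d + 4 * V < a₀) → Answer xs → Answer {lo} (cons p q x xs)
    decide (yes h) _ _ = inj₁ (far-pair x₀ x h)
    decide (no _) (yes h) _ = inj₁ (far-pair x x₀ h)
    decide (no _) (no _) (inj₁ w) = inj₁ w
    decide (no h) (no h′) (inj₂ (ys , e)) = inj₂ (cons p q (near wid₀ x (≮⇒≥ h) (≮⇒≥ h′)) ys , s≤s e)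
      where
      wid₀ : d₀ ≤ a₀ + 4 * V
      wid₀ = ≤-trans (Sh-narrow x₀) (≤-reflexive (cong (λ z → a₀ + 4 * z) (top≡V s₀)))

  family-wave : ∀ n (F : Family P (suc m) f) → 41 * 4 ≤ total n f F → Wave P (u ++ suc m ∷ v)
  family-wave n F h = start (nonzero-row {n} (λ s → len (F s)) (≤-trans (s≤s z≤n) h))
    where
    CellRows : ℕ → ℕ → Set
    CellRows a₀ s = Σ (OL (Tagged 41 (Cell a₀ s)) 0) λ ys → len (F s) ≤ len ys
    pick : ∀ {a₀} → (∀ {s} → s < n → CellRows a₀ s) → Wave P (u ++ suc m ∷ v)
    pick {a₀} rs = found (pigeonhole {41} {4} count (s≤s z≤n) enough)
      where
      -- Rows from `n` on get the empty list; the sums below `n` do not see them.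
      T : ∀ s → OL (Tagged 41 (Cell a₀ s)) 0
      T s with s <? n
      ... | yes s<n = proj₁ (rs s<n)
      ... | no  _   = []
      len-T : ∀ {s} → s < n → len (F s) ≤ len (T s)
      len-T {s} h with s <? n
      ... | yes s<n = proj₂ (rs s<n)
      ... | no ¬h   = ⊥-elim (¬h h)
      count : ℕ → ℕ
      count t = sum< n (λ s → len (select t (T s)))
      enough : 41 * 4 ≤ sum< 41 count
      enough = ≤-trans h (≤-trans (sum<-mono-< n (λ {s} lt → ≤-trans (len-T lt) (sum-select (T s))))
        (≤-reflexive (sum<-comm n 41 (λ s t → len (select t (T s))))))
      -- A cell holds at most one tree of each row, so four trees in it belong to four rows.
      found : (∃ λ t → t < 41 × 4 ≤ count t) → Wave P (u ++ suc m ∷ v)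
      found (t , _ , four) = conclude (spread-rows {n} (λ s → len (select t (T s))) (λ s → one-per-cell (select t (T s))) four)
        where
        conclude : (∃ λ s → ∃ λ s′ → 3 + s ≤ s′ × s′ < n × 1 ≤ len (select t (T s)) × 1 ≤ len (select t (T s′))) →
          Wave P (u ++ suc m ∷ v)
        conclude (s , s′ , lt , _ , p , q) = both (first (select t (T s)) p) (first (select t (T s′)) q)
          where
          both : (∃ λ a → ∃ λ b → Cell a₀ s t a b) → (∃ λ a → ∃ λ b → Cell a₀ s′ t a b) → Wave P (u ++ suc m ∷ v)
          both (_ , _ , x) (_ , _ , y) = same-cell lt x y
    start : (∃ λ s → 1 ≤ len (F s)) → Wave P (u ++ suc m ∷ v)
    start (s₀ , p) = from (first (F s₀) p)
      where
      from : (∃ λ a → ∃ λ d → Sh P (suc m) (f s₀) a d) → Wave P (u ++ suc m ∷ v)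
      from (a₀ , d₀ , x₀) = [ id , pick ]′ (rows n (λ s → search x₀ s (F s)))

-- Shapes of permutations

^-distrib-* : ∀ a b n → (a * b) ^ n ≡ a ^ n * b ^ n
^-distrib-* a b zero    = refl
^-distrib-* a b (suc n) rewrite ^-distrib-* a b n = rearrange a b (a ^ n) (b ^ n)
  where
  rearrange : ∀ a b x y → a * b * (x * y) ≡ a * x * (b * y)
  rearrange = solve-∀

-- 164 = 41 · 4: four trees in one of 41 cells.
straddle-hits : ∀ {m i u v} → Straddle (suc m) i u v → i < m → Hits m (u ++ suc m ∷ v)
straddle-hits {m} {i} {u} {v} str i<m = rate ^ suc m * 164 , *-mono-≤ (1≤pow (suc m) 1≤rate) (s≤s {0} {163} z≤n) , result
  where
  j : ℕ
  j = m ∸ i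
  i+j≡m : i + j ≡ m
  i+j≡m = m+[n∸m]≡n (<⇒≤ i<m)
  rows≡ : j + suc i ≡ suc m
  rows≡ = trans (+-suc j i) (cong suc (trans (+-comm j i) i+j≡m))
  budget : ∀ D y → (rate * D) ^ i * (rate * ((rate * D) ^ j * y)) ≡ rate ^ suc m * y * D ^ m
  budget D y = begin
    (rate * D) ^ i * (rate * ((rate * D) ^ j * y)) ≡⟨ regroup ((rate * D) ^ i) ((rate * D) ^ j) rate y ⟩
    rate * ((rate * D) ^ i * (rate * D) ^ j) * y   ≡⟨ cong (λ z → rate * z * y) (^-distribˡ-+-* (rate * D) i j) ⟨
    rate * (rate * D) ^ (i + j) * y                ≡⟨ cong (λ z → rate * (rate * D) ^ z * y) i+j≡m ⟩
    rate * (rate * D) ^ m * y                      ≡⟨ cong (λ z → rate * z * y) (^-distrib-* rate D m) ⟩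
    rate * (rate ^ m * D ^ m) * y                  ≡⟨ regroup′ rate (rate ^ m) (D ^ m) y ⟩
    rate ^ suc m * y * D ^ m                       ∎
    where
    open ≡-Reasoning
    regroup : ∀ a b r y → a * (r * (b * y)) ≡ r * (a * b) * y
    regroup = solve-∀
    regroup′ : ∀ r a b y → r * (a * b) * y ≡ r * a * y * b
    regroup′ = solve-∀
  result : ∀ (P : ℕ → Set) D → 1 ≤ D → (∀ {x} → P x → x < 2 ^ D) → (xs : Pts P 0) → rate ^ suc m * 164 * D ^ m ≤ len xs →
    Wave P (u ++ suc m ∷ v)
  result P D 1≤D bd xs h = finish (subst (λ k → Grown D bd 1≤D i k D 164) rows≡
    (grow-family D bd 1≤D i j 164 (s≤s z≤n) xs (≤-trans (≤-reflexive (budget D 164)) h)))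
    where
    finish : Grown D bd 1≤D i (suc m) D 164 → Wave P (u ++ suc m ∷ v)
    finish (g , G , row , e) = family-wave str row i<m D G e

record Word (k : ℕ) (w : List ℕ) : Set where
  field
    unique   : AllPairs _≢_ w
    bounded  : All (_< k) w
    complete : ∀ {r} → r < k → r ∈ w

-- By `classify`, `peaky-peak` and `valley-no-peak`, the words of permutations in this family are
-- exactly those without peaks.
data Valley : ℕ → List ℕ → Set where
  none  : Valley 0 []
  left  : ∀ {k w} → All (_< k) w → Valley k w → Valley (suc k) (k ∷ w)
  right : ∀ {k w} → All (_< k) w → Valley k w → Valley (suc k) (w ++ k ∷ [])

-- Extreme maxima are removed until one is interior. The index is the number of ranks minus 2, which
-- is the exponent in `peaky-hits` and one less than for a valley of the same length.
data Peaky : ℕ → List ℕ → Set where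
  inner : ∀ {m i u v} → Straddle (suc m) i u v → i < m → Peaky m (u ++ suc m ∷ v)
  left  : ∀ {e w} → All (_< 2 + e) w → Peaky e w → Peaky (suc e) ((2 + e) ∷ w)
  right : ∀ {e w} → All (_< 2 + e) w → Peaky e w → Peaky (suc e) (w ++ (2 + e) ∷ [])

singleton-hits : Hits 0 (0 ∷ [])
singleton-hits = 2 , s≤s z≤n , result
  where
  result : ∀ (P : ℕ → Set) D → 1 ≤ D → (∀ {x} → P x → x < 2 ^ D) → (xs : Pts P 0) → 2 ≤ len xs → Wave P (0 ∷ [])
  result P D _ _ (cons {a = a} _ _ (refl , p) (cons {a = b} a<b _ (refl , q) _)) _ =
    a , (0 , b ∸ a) ∷ [] , b , step p (m<n⇒0<n∸m a<b) (m+[n∸m]≡n (<⇒≤ a<b)) (stop q) , refl ,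
    λ { (here refl) (here refl) () }
  result P D _ _ (cons _ _ _ []) (s≤s ())

valley-hits : ∀ {k w} → Valley (suc k) w → Hits k w
valley-hits {zero}  (left _ none)   = singleton-hits
valley-hits {zero}  (right _ none)  = singleton-hits
valley-hits {suc k} (left w<k val)  = peelˡ {k} w<k (valley-hits val)
valley-hits {suc k} (right w<k val) = peelʳ {k} w<k (valley-hits val)

peaky-hits : ∀ {e w} → Peaky e w → Hits e w
peaky-hits (inner str i<m) = straddle-hits str i<m
peaky-hits (left {e} w<k p)    = peelˡ {e} w<k (peaky-hits p)
peaky-hits (right {e} w<k p)   = peelʳ {e} w<k (peaky-hits p)

data Peak : List ℕ → Set where
  here  : ∀ {a b c w} → a < b → c < b → Peak (a ∷ b ∷ c ∷ w)
  there : ∀ {a w} → Peak w → Peak (a ∷ w)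

Peak-++ : ∀ {w} w′ → Peak w → Peak (w ++ w′)
Peak-++ w′ (here p q) = here p q
Peak-++ w′ (there p)  = there (Peak-++ w′ p)

inner-peak : ∀ {K x u y v} → All (_< K) (x ∷ u) → y < K → Peak (x ∷ u ++ K ∷ y ∷ v)
inner-peak {u = []}    (p ∷ _)  q = here p q
inner-peak {u = _ ∷ _} (_ ∷ ps) q = there (inner-peak ps q)

peaky-peak : ∀ {e w} → Peaky e w → Peak w
peaky-peak (left _ p)  = there (peaky-peak p)
peaky-peak (right _ p) = Peak-++ _ (peaky-peak p)
peaky-peak (inner {u = u} {v} str _) = go u v u<K v<K sides
  where
  open Straddle str
  go : ∀ {K i} u v → All (_< K) u → All (_< K) v → (i ∈ u × suc i ∈ v) ⊎ (i ∈ v × suc i ∈ u) → Peak (u ++ K ∷ v)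
  go (x ∷ u) (y ∷ v) ps (q ∷ _) _ = inner-peak ps q
  go [] v _ _ (inj₁ (() , _))
  go [] v _ _ (inj₂ (_ , ()))
  go (x ∷ u) [] _ _ (inj₁ (_ , ()))
  go (x ∷ u) [] _ _ (inj₂ (() , _))

peak-unsnoc : ∀ {k} w → All (_< k) w → Peak (w ++ k ∷ []) → Peak w
peak-unsnoc [] _ (there ())
peak-unsnoc (x ∷ []) _ (there (there ()))
peak-unsnoc (x ∷ y ∷ []) (_ ∷ y<k ∷ _) (here _ k<y) = ⊥-elim (<-asym y<k k<y)
peak-unsnoc (x ∷ y ∷ z ∷ w) _ (here p q) = here p q
peak-unsnoc (x ∷ w@(_ ∷ _)) (_ ∷ ps) (there p) = there (peak-unsnoc w ps p)

valley-no-peak : ∀ {k w} → Valley k w → ¬ Peak w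
valley-no-peak (left (b<k ∷ _) _) (here k<b _) = <-asym b<k k<b
valley-no-peak (left _ val) (there p)          = valley-no-peak val p
valley-no-peak (right {w = w} w<k val) p       = valley-no-peak val (peak-unsnoc w w<k p)

-- A discrete intermediate value argument: on the way up from a number in `Q` to one in `R`, some
-- single step leads from `Q` to `R`. It supplies the ranks `i` and `suc i` of a `Straddle`.
switch : ∀ {Q R : ℕ → Set} n {x} → (∀ {r} → Q r → R r → ⊥) → (∀ {r} → r ≤ n + x → Q r ⊎ R r) → Q x → R (n + x) →
  ∃ λ i → i < n + x × Q i × R (suc i)
switch zero dis _ q r = ⊥-elim (dis q r)
switch (suc n) {x} dis cov q r with cov (n≤1+n (n + x))
... | inj₁ q′ = n + x , ≤-refl , q′ , r
... | inj₂ r′ with switch n dis (cov ∘ m≤n⇒m≤1+n) q r′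
...   | i , i< , a = i , m≤n⇒m≤1+n i< , a

switch-≤ : ∀ {Q R : ℕ → Set} {x y} → x ≤ y → (∀ {r} → Q r → R r → ⊥) → (∀ {r} → r ≤ y → Q r ⊎ R r) → Q x → R y →
  ∃ λ i → i < y × Q i × R (suc i)
switch-≤ {Q} {R} {x} {y} x≤y dis cov q r =
  subst (λ z → ∃ λ i → i < z × Q i × R (suc i)) e
    (switch (y ∸ x) dis (λ h → cov (≤-trans h (≤-reflexive e))) q (subst R (sym e) r))
  where
  e : y ∸ x + x ≡ y
  e = m∸n+n≡m x≤y

record Halves (k : ℕ) (u v : List ℕ) : Set where
  field
    u-unique : AllPairs _≢_ u
    v-unique : AllPairs _≢_ v
    disjoint : ∀ {r} → r ∈ u → r ∈ v → ⊥
    k∉u      : ¬ k ∈ u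
    k∉v      : ¬ k ∈ v

All-++ʳ : ∀ {A : Set} {Q : A → Set} u {v} → All Q (u ++ v) → All Q v
All-++ʳ []      qs       = qs
All-++ʳ (x ∷ u) (q ∷ qs) = All-++ʳ u qs

halves : ∀ {k} u {v} → AllPairs _≢_ (u ++ k ∷ v) → Halves k u v
halves [] (p ∷ ps) = record { u-unique = [] ; v-unique = ps ; disjoint = λ () ; k∉u = λ () ; k∉v = λ i → All-lookup p i refl }
halves {k} (x ∷ u) {v} (p ∷ ps) = record
  { u-unique = All-++ˡ u p ∷ u-unique
  ; v-unique = v-unique
  ; disjoint = λ { (here refl) j → All-lookup (All-++ʳ u p) (there j) refl ; (there i) j → disjoint i j }
  ; k∉u = λ { (here e) → All-lookup (All-++ʳ u p) (here refl) (sym e) ; (there i) → k∉u i }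
  ; k∉v = k∉v
  }
  where open Halves (halves u ps)

Classified : ℕ → List ℕ → Set
Classified k w = Valley k w ⊎ ∃ λ e → k ≡ 2 + e × Peaky e w

module _ {k : ℕ} {u v : List ℕ} (wd : Word (suc k) (u ++ k ∷ v)) where
  open Halves (halves u (Word.unique wd))

  strict : ∀ {x} → ¬ k ∈ x → All (_< suc k) x → All (_< k) x
  strict {x} k∉ bd = All-tabulate x (λ i → ≤∧≢⇒< (s≤s⁻¹ (All-lookup bd i)) (λ { refl → k∉ i }))

  u<k : All (_< k) u
  u<k = strict k∉u (All-++ˡ u (Word.bounded wd))

  v<k : All (_< k) v
  v<k with All-++ʳ u (Word.bounded wd)
  ... | _ ∷ qs = strict k∉v qs

  member : ∀ {r} → r < k → r ∈ u ⊎ r ∈ v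
  member r<k with ∈-insert⁻ u (Word.complete wd (m≤n⇒m≤1+n r<k))
  ... | inj₁ refl = ⊥-elim (<-irrefl refl r<k)
  ... | inj₂ i    = ∈-++⁻ u i

  u-word : (∀ {r} → ¬ r ∈ v) → Word k u
  u-word ∉v = record { unique = u-unique ; bounded = u<k ; complete = λ h → [ id , ⊥-elim ∘ ∉v ]′ (member h) }

  v-word : (∀ {r} → ¬ r ∈ u) → Word k v
  v-word ∉u = record { unique = v-unique ; bounded = v<k ; complete = λ h → [ ⊥-elim ∘ ∉u , id ]′ (member h) }

  interior : ∀ {k′ i y} → k ≡ k′ → i < y → y < k′ → (i ∈ u × suc i ∈ v) ⊎ (i ∈ v × suc i ∈ u) →
    Classified (suc k) (u ++ k ∷ v)
  interior {suc m} refl i<y y<k s = inj₂ (m , refl , inner straddle (<-≤-trans i<y (s≤s⁻¹ y<k)))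
    where
    straddle : Straddle (suc m) _ u v
    straddle = record { u-unique = u-unique ; v-unique = v-unique ; u<K = u<k ; v<K = v<k ; disjoint = disjoint ; sides = s }

  two-sided : ∀ {x y} → x ∈ u → y ∈ v → Classified (suc k) (u ++ k ∷ v)
  two-sided {x} {y} x∈u y∈v with ≤-total x y
  ... | inj₁ x≤y with switch-≤ x≤y disjoint (λ r≤y → member (≤-<-trans r≤y (All-lookup v<k y∈v))) x∈u y∈v
  ...   | i , i<y , p , q = interior refl i<y (All-lookup v<k y∈v) (inj₁ (p , q))
  two-sided {x} {y} x∈u y∈v | inj₂ y≤x
    with switch-≤ y≤x (λ p q → disjoint q p) (λ r≤x → [ inj₂ , inj₁ ]′ (member (≤-<-trans r≤x (All-lookup u<k x∈u)))) y∈v x∈u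
  ... | i , i<x , p , q = interior refl i<x (All-lookup u<k x∈u) (inj₂ (p , q))

-- The largest letter is taken out. At an end it leaves a shorter word for the recursion; with
-- letters on both sides, `two-sided` finds consecutive ranks on different sides.
classify : ∀ k w → Word k w → Classified k w
classify zero [] wd = inj₁ none
classify zero (x ∷ w) wd with Word.bounded wd
... | () ∷ _
classify (suc k) w wd with ∈-∃++ (Word.complete wd ≤-refl)
... | [] , v , refl = step-left (classify k v (v-word {u = []} wd (λ ())))
  where
  step-left : Classified k v → Classified (suc k) (k ∷ v)
  step-left (inj₁ val)            = inj₁ (left (v<k {u = []} wd) val)
  step-left (inj₂ (e , refl , p)) = inj₂ (suc e , refl , left (v<k {u = []} wd) p)
... | u@(_ ∷ _) , [] , refl = step-right (classify k u (u-word wd (λ ())))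
  where
  step-right : Classified k u → Classified (suc k) (u ++ k ∷ [])
  step-right (inj₁ val)            = inj₁ (right (u<k wd) val)
  step-right (inj₂ (e , refl , p)) = inj₂ (suc e , refl , right (u<k wd) p)
... | _ ∷ _ , _ ∷ _ , refl = two-sided wd (here refl) (here refl)

-- From words to permutations

rank : ∀ {k} → Perm k → Fin k → ℕ
rank π i = toℕ (π ⟨$⟩ʳ i)

rank-injective : ∀ {k} (π : Perm k) {i j} → rank π i ≡ rank π j → i ≡ j
rank-injective π e = trans (sym (inverseˡ π)) (trans (cong (π ⟨$⟩ˡ_) (toℕ-injective e)) (inverseˡ π))

word : ∀ {k} → Perm k → List ℕ
word π = List.tabulate (rank π)

word-Word : ∀ {k} (π : Perm k) → Word k (word π)
word-Word π = record
  { unique   = AllPairs.tabulate⁺ (λ ne → ne ∘ rank-injective π)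
  ; bounded  = All.tabulate⁺ (λ i → toℕ<n (π ⟨$⟩ʳ i))
  ; complete = λ {r} h → subst (_∈ word π) (trans (cong toℕ (inverseʳ π)) (toℕ-fromℕ< h)) (∈-tabulate⁺ (π ⟨$⟩ˡ fromℕ< h))
  }

PeakAt : ∀ {k} → (Fin k → ℕ) → Set
PeakAt {k} f = Σ (Fin k) λ i → Σ (Fin k) λ j → Σ (Fin k) λ l →
  (suc (toℕ j) ≡ toℕ i) × (suc (toℕ i) ≡ toℕ l) × f j < f i × f l < f i

peak⇒Peak : ∀ {k} (f : Fin k → ℕ) → PeakAt f → Peak (List.tabulate f)
peak⇒Peak f (Fin.suc Fin.zero , Fin.zero , Fin.suc (Fin.suc Fin.zero) , refl , refl , p , q) = here p q
peak⇒Peak f (Fin.suc i@(Fin.suc _) , Fin.suc j , Fin.suc l , e , e′ , p , q) =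
  there (peak⇒Peak (f ∘ Fin.suc) (i , j , l , suc-injective e , suc-injective e′ , p , q))

Peak⇒peak : ∀ {k} (f : Fin k → ℕ) → Peak (List.tabulate f) → PeakAt f
Peak⇒peak {suc (suc (suc k))} f (here p q) = Fin.suc Fin.zero , Fin.zero , Fin.suc (Fin.suc Fin.zero) , refl , refl , p , q
Peak⇒peak {suc k} f (there p) with Peak⇒peak (f ∘ Fin.suc) p
... | i , j , l , e , e′ , a , b = Fin.suc i , Fin.suc j , Fin.suc l , cong suc e , cong suc e′ , a , b

no-peak-valley : ∀ {k} (π : Perm k) → ¬ HasPeak π → Valley k (word π)
no-peak-valley {k} π ¬peak with classify k (word π) (word-Word π)
... | inj₁ val         = val
... | inj₂ (_ , _ , p) = ⊥-elim (¬peak (Peak⇒peak (rank π) (peaky-peak p)))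

peak-hits : ∀ {k} (π : Perm k) → HasPeak π → Hits (k ∸ 2) (word π)
peak-hits {k} π peak with classify k (word π) (word-Word π)
... | inj₁ val            = ⊥-elim (valley-no-peak val (peak⇒Peak (rank π) peak))
... | inj₂ (_ , refl , p) = peaky-hits p

record Points {k : ℕ} (P : ℕ → Set) (g : Fin k → ℕ) (a : ℕ) (zs : List (ℕ × ℕ)) : Set where
  constructor points
  field
    x      : Fin (suc k) → ℕ
    start  : x Fin.zero ≡ a
    rising : ∀ i → x (inject₁ i) < x (Fin.suc i)
    mem    : ∀ i → P (x i)
    gaps   : ∀ i → (g i , gap x i) ∈ zs

path-points : ∀ {k P a b zs} (g : Fin k → ℕ) → Path P a zs b → map proj₁ zs ≡ List.tabulate g → Points P g a zs
path-points {zero} {a = a} g (stop p) _ = points (λ _ → a) refl (λ ()) (λ _ → p) (λ ())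
path-points {suc k} {P} {a} g (step {c = c} {g = d} p 1≤d refl ps) e = extend (∷-injective e)
  where
  extend : _ × _ → _
  extend (refl , e′) = cons-points (path-points (g ∘ Fin.suc) ps e′)
    where
    cons-points : Points P (g ∘ Fin.suc) (a + d) _ → Points P g a _
    cons-points (points x x₀ rising mem gaps) = points y refl y-rising y-mem y-gaps
      where
      y : Fin (suc (suc k)) → ℕ
      y Fin.zero    = a
      y (Fin.suc i) = x i
      y-rising : ∀ i → y (inject₁ i) < y (Fin.suc i)
      y-rising Fin.zero    = <-≤-trans (m<m+n a 1≤d) (≤-reflexive (sym x₀))
      y-rising (Fin.suc i) = rising i
      y-mem : ∀ i → P (y i)
      y-mem Fin.zero    = p
      y-mem (Fin.suc i) = mem i
      y-gaps : ∀ i → (g i , gap y i) ∈ _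
      y-gaps Fin.zero    = here (cong (g Fin.zero ,_) (trans (cong (_∸ a) x₀) (m+n∸m≡n a d)))
      y-gaps (Fin.suc i) = there (gaps i)

rising-gaps : ∀ {k} (π : Perm k) (x : Fin (suc k) → ℕ) → (∀ i j → rank π i < rank π j → gap x i < gap x j) →
  ∀ i j → (gap x j < gap x i) ⇔ ((π ⟨$⟩ʳ j) Fin.< (π ⟨$⟩ʳ i))
rising-gaps π x mono i j = mk⇔ to (mono j i)
  where
  to : gap x j < gap x i → rank π j < rank π i
  to lt with <-cmp (rank π j) (rank π i)
  ... | tri< h _ _ = h
  ... | tri≈ _ e _ = ⊥-elim (<-irrefl (cong (gap x) (rank-injective π e)) lt)
  ... | tri> _ _ h = ⊥-elim (<-asym lt (mono i j h))

Of : ∀ {n} → Subset n → ℕ → Set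
Of {n} A x = Σ (Fin n) λ i → toℕ i ≡ x × i ∈ₛ A

wave⇒contains : ∀ {k n} (π : Perm k) (A : Subset n) → Wave (Of A) (word π) → ContainsWave π A
wave⇒contains {k} {n} π A (a , zs , b , p , e , mono) = convert (path-points (rank π) p e)
  where
  convert : Points (Of A) (rank π) a zs → ContainsWave π A
  convert (points x _ rising mem gaps) = y , (y-rising , rising-gaps π (toℕ ∘ y) y-mono) , λ i → proj₂ (proj₂ (mem i))
    where
    y : Fin (suc k) → Fin n
    y i = proj₁ (mem i)
    y≡x : ∀ i → toℕ (y i) ≡ x i
    y≡x i = proj₁ (proj₂ (mem i))
    gap≡ : ∀ i → gap (toℕ ∘ y) i ≡ gap x i
    gap≡ i = cong₂ _∸_ (y≡x (Fin.suc i)) (y≡x (inject₁ i))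
    y-rising : ∀ i → toℕ (y (inject₁ i)) < toℕ (y (Fin.suc i))
    y-rising i = subst₂ _<_ (sym (y≡x (inject₁ i))) (sym (y≡x (Fin.suc i))) (rising i)
    y-mono : ∀ i j → rank π i < rank π j → gap (toℕ ∘ y) i < gap (toℕ ∘ y) j
    y-mono i j h = subst₂ _<_ (sym (gap≡ i)) (sym (gap≡ j)) (mono (gaps i) (gaps j) h)

shifted-points : ∀ {n} (A : Subset n) o → Σ (Pts (λ x → Σ (Fin n) λ i → o + toℕ i ≡ x × i ∈ₛ A) o) λ xs → len xs ≡ ∣ A ∣
shifted-points [] o = [] , refl
shifted-points {suc n} (b ∷ A) o = extend b (shifted-points A (suc o))
  where
  Shifted : ∀ {m} → Subset m → ℕ → ℕ → Set
  Shifted {m} B o x = Σ (Fin m) λ i → o + toℕ i ≡ x × i ∈ₛ B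
  shift : ∀ {b x} → Shifted A (suc o) x → Shifted (b ∷ A) o x
  shift (i , e , i∈) = Fin.suc i , trans (+-suc o (toℕ i)) e , there i∈
  extend : ∀ b → (Σ (Pts (Shifted A (suc o)) (suc o)) λ xs → len xs ≡ ∣ A ∣) → Σ (Pts (Shifted (b ∷ A) o) o) λ xs → len xs ≡ ∣ b ∷ A ∣
  extend true (xs , e)  = cons ≤-refl ≤-refl (refl , Fin.zero , +-identityʳ o , here) (Pts-map shift xs) , cong suc (trans (len-OL-map _ xs) e)
  extend false (xs , e) = weaken (n≤1+n o) (Pts-map shift xs) , trans (len-weaken _ (Pts-map shift xs)) (trans (len-OL-map _ xs) e)

Forces : ∀ {k} → ℕ → Perm k → Set
Forces e π = ∃ λ K → ∀ {n} D → 1 ≤ D → n ≤ 2 ^ D → (A : Subset n) → K * D ^ e ≤ ∣ A ∣ → ContainsWave π A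

hits⇒forces : ∀ {k e} (π : Perm k) → Hits e (word π) → Forces e π
hits⇒forces {e = e} π (K , _ , hits) = K , forces
  where
  forces : ∀ {n} D → 1 ≤ D → n ≤ 2 ^ D → (A : Subset n) → K * D ^ e ≤ ∣ A ∣ → ContainsWave π A
  forces {n} D 1≤D n≤ A h = go (shifted-points A 0)
    where
    go : (Σ (Pts (Of A) 0) λ xs → len xs ≡ ∣ A ∣) → ContainsWave π A
    go (xs , eq) = wave⇒contains π A (hits (Of A) D 1≤D (λ { (i , refl , _) → <-≤-trans (toℕ<n i) n≤ }) xs (≤-trans h (≤-reflexive (sym eq))))

log-upper : ∀ n → n < 2 ^ suc ⌊log₂ n ⌋
log-upper n with n <? 2 ^ suc ⌊log₂ n ⌋
... | yes h = h
... | no ¬h = ⊥-elim (1+n≰n (≤-trans (≤-reflexive (sym (⌊log₂[2^n]⌋≡n (suc ⌊log₂ n ⌋)))) (⌊log₂⌋-mono-≤ (≮⇒≥ ¬h))))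

log-≤ : ∀ t {n} → n < 2 ^ suc t → ⌊log₂ n ⌋ ≤ t
log-≤ zero {zero} _ = z≤n
log-≤ zero {suc zero} _ = z≤n
log-≤ zero {suc (suc n)} (s≤s (s≤s ()))
log-≤ (suc t) {n} h = ≤-trans (m≤n+m∸n ⌊log₂ n ⌋ 1) (+-monoʳ-≤ 1 (≤-trans (≤-reflexive (sym (⌊log₂⌊n/2⌋⌋≡⌊log₂n⌋∸1 n))) (log-≤ t half)))
  where
  half : ⌊ n /2⌋ < 2 ^ suc t
  half = *-cancelˡ-< 2 _ _ (≤-<-trans (≤-trans (≤-reflexive (cong (⌊ n /2⌋ +_) (+-identityʳ _))) (≤-trans (+-monoʳ-≤ ⌊ n /2⌋ (⌊n/2⌋≤⌈n/2⌉ n)) (≤-reflexive (⌊n/2⌋+⌈n/2⌉≡n n)))) h)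

log-lower : ∀ {n} → 1 ≤ n → 2 ^ ⌊log₂ n ⌋ ≤ n
log-lower {n} 1≤n with 2 ^ ⌊log₂ n ⌋ ≤? n
... | yes h = h
... | no ¬h with ⌊log₂ n ⌋ in eq
...   | zero  = 1≤n
...   | suc t = ⊥-elim (1+n≰n (≤-trans (≤-reflexive (sym eq)) (log-≤ t (≰⇒> ¬h))))

1≤log : ∀ {n} → 2 ≤ n → 1 ≤ ⌊log₂ n ⌋
1≤log h = ≤-trans (≤-reflexive (sym (⌊log₂[2^n]⌋≡n 1))) (⌊log₂⌋-mono-≤ h)

-- Colourings

-- does (s ≟ t) would reduce to s ≡ᵇ t, out of reach of a case split on s ≟ t.
same : ℕ → ℕ → Bool
same s t with s ≟ t
... | yes _ = inside
... | no  _ = outside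

same⇒≡ : ∀ {s t} → same s t ≡ inside → s ≡ t
same⇒≡ {s} {t} e with s ≟ t
same⇒≡ _ | yes p = p
same⇒≡ () | no _

colour-class : ∀ {n r} → (Fin n → Fin r) → ℕ → Subset n
colour-class c t = Vec.tabulate (λ i → same (toℕ (c i)) t)

∈-class : ∀ {n r} (c : Fin n → Fin r) t {i} → i ∈ₛ colour-class c t → toℕ (c i) ≡ t
∈-class c t {i} i∈ = same⇒≡ (trans (sym (lookup∘tabulate (λ i → same (toℕ (c i)) t) i)) ([]=⇒lookup i∈))

∣class∣ : ∀ {n r} (c : Fin (suc n) → Fin r) t →
  δ (toℕ (c Fin.zero)) t + ∣ colour-class (c ∘ Fin.suc) t ∣ ≡ ∣ colour-class c t ∣
∣class∣ c t with toℕ (c Fin.zero) ≟ t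
... | yes _ = refl
... | no  _ = refl

sum-classes : ∀ {n r} (c : Fin n → Fin r) → sum< r (λ t → ∣ colour-class c t ∣) ≡ n
sum-classes {zero}  {r} c = sum<-0 r
sum-classes {suc n} {r} c = begin
  sum< r (λ t → ∣ colour-class c t ∣)                                                 ≡⟨ sum<-cong r (λ t → ∣class∣ c t) ⟨
  sum< r (λ t → δ (toℕ (c Fin.zero)) t + ∣ colour-class (c ∘ Fin.suc) t ∣)            ≡⟨ sum<-+ r (δ (toℕ (c Fin.zero))) _ ⟩
  sum< r (δ (toℕ (c Fin.zero))) + sum< r (λ t → ∣ colour-class (c ∘ Fin.suc) t ∣)     ≡⟨ cong₂ _+_ (sum<-δ (toℕ<n (c Fin.zero))) (sum-classes (c ∘ Fin.suc)) ⟩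
  suc n                                                                               ∎
  where
  open ≡-Reasoning
  sum<-cong : ∀ n {c d} → (∀ i → c i ≡ d i) → sum< n c ≡ sum< n d
  sum<-cong zero    h = refl
  sum<-cong (suc n) h = cong₂ _+_ (sum<-cong n h) (h n)

class-wave⇒mono : ∀ {k n r} (π : Perm k) (c : Fin n → Fin r) t → ContainsWave π (colour-class c t) → HasMonoWave π c
class-wave⇒mono π c t (x , wave , mem) = x , wave ,
  λ i → toℕ-injective (trans (∈-class c t (mem i)) (sym (∈-class c t (mem Fin.zero))))

-- Upper bounds for `g` and `P`

forces⇒O-g : ∀ {k e} (π : Perm k) → Forces e π → BigO (IsG π) (logPow e)
forces⇒O-g {k} {e} π (K , forces) = K * 2 ^ e , 2 , bound
  where
  bound : ∀ n → 2 ≤ n → ∀ h → IsG π n h → h ≤ K * 2 ^ e * logPow e n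
  bound n 2≤n h ((A , free , refl) , _) with K * suc ⌊log₂ n ⌋ ^ e ≤? ∣ A ∣
  ... | yes big = ⊥-elim (free (forces (suc ⌊log₂ n ⌋) (s≤s z≤n) (<⇒≤ (log-upper n)) A big))
  ... | no ¬big = ≤-trans (<⇒≤ (≰⇒> ¬big)) (≤-trans (*-monoʳ-≤ K (≤-trans (^-monoˡ-≤ e 1+L≤2L) (≤-reflexive (^-distrib-* 2 _ e)))) (≤-reflexive (sym (*-assoc K (2 ^ e) _))))
    where
    1+L≤2L : suc ⌊log₂ n ⌋ ≤ 2 * ⌊log₂ n ⌋
    1+L≤2L = +-mono-≤ (1≤log 2≤n) (≤-reflexive (sym (+-identityʳ _)))

n≤2^n : ∀ n → n ≤ 2 ^ n
n≤2^n zero    = z≤n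
n≤2^n (suc n) = +-mono-≤ (1≤pow n (s≤s {0} {1} z≤n)) (≤-trans (n≤2^n n) (≤-reflexive (sym (+-identityʳ _))))

-- Supplies the constant for `P`: an interval of `2 ^ c * (r * L ^ e)` points has logarithm at most
-- `c + (2 + e) * L`, so `c` has to outweigh its own contribution to that logarithm.
exp-beats-poly : ∀ K e → ∃ λ c → K * (c + (2 + e)) ^ e ≤ 2 ^ c
exp-beats-poly K e = c , (begin
  K * (c + (2 + e)) ^ e      ≤⟨ *-mono-≤ (n≤2^n K) (^-monoˡ-≤ e linear) ⟩
  2 ^ K * (2 ^ z) ^ e        ≡⟨ cong (2 ^ K *_) (^-*-assoc 2 z e) ⟩
  2 ^ K * 2 ^ (z * e)        ≡⟨ ^-distribˡ-+-* 2 K (z * e) ⟨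
  2 ^ c                      ∎)
  where
  open ≤-Reasoning
  -- The base of the power is at most `y * y`, hence at most `2 ^ z`, and the factor `K` is at most
  -- `2 ^ K`; `c` is the resulting exponent.
  y z c : ℕ
  y = K + 3 + 3 * e
  z = y + y
  c = K + z * e
  linear : c + (2 + e) ≤ 2 ^ z
  linear = begin
    K + (y + y) * e + (2 + e)  ≤⟨ m≤m+n _ (1 + 2 * e) ⟩
    K + (y + y) * e + (2 + e) + (1 + 2 * e) ≡⟨ regroup K y e ⟩
    y + (y + y) * e ≤⟨ m≤m+n _ ((K + 2 + e) * y) ⟩
    y + (y + y) * e + (K + 2 + e) * y ≡⟨ square K e y ⟩
    y * y                      ≤⟨ *-mono-≤ (n≤2^n y) (n≤2^n y) ⟩
    2 ^ y * 2 ^ y              ≡⟨ ^-distribˡ-+-* 2 y y ⟨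
    2 ^ (y + y)                ∎
    where
    regroup : ∀ K y e → K + (y + y) * e + (2 + e) + (1 + 2 * e) ≡ K + 3 + 3 * e + (y + y) * e
    regroup = solve-∀
    square : ∀ K e y → y + (y + y) * e + (K + 2 + e) * y ≡ (K + 3 + 3 * e) * y
    square = solve-∀

-- By minimality of `h` it is enough that `M` points force a wave. Some colour class has at least
-- `2 ^ c * L ^ e` elements, and this reaches `K * D ^ e` by the choice of `c`.
forces⇒O-P : ∀ {k e} (π : Perm k) → Forces e π → BigO (IsP π) (rLogPow e)
forces⇒O-P {k} {e} π (K , forces) = 2 ^ c , 2 , bound
  where
  c : ℕ
  c = proj₁ (exp-beats-poly K e)
  bound : ∀ r → 2 ≤ r → ∀ h → IsP π r h → h ≤ 2 ^ c * rLogPow e r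
  bound r 2≤r h (_ , _ , least) with h ≤? 2 ^ c * rLogPow e r
  ... | yes p = p
  ... | no ¬p = ⊥-elim (least M 1≤M (≰⇒> ¬p) mono)
    where
    L M D : ℕ
    L = ⌊log₂ r ⌋
    M = 2 ^ c * rLogPow e r
    D = c + (2 + e) * L
    1≤L : 1 ≤ L
    1≤L = 1≤log 2≤r
    1≤M : 1 ≤ M
    1≤M = *-mono-≤ (1≤pow c (s≤s {0} {1} z≤n)) (*-mono-≤ (≤-trans (s≤s z≤n) 2≤r) (1≤pow e 1≤L))
    1≤D : 1 ≤ D
    1≤D = ≤-trans (*-mono-≤ {1} {2 + e} (s≤s z≤n) 1≤L) (m≤n+m _ c)
    M≤2^D : M ≤ 2 ^ D
    M≤2^D = begin
      2 ^ c * (r * L ^ e)                     ≤⟨ *-monoʳ-≤ (2 ^ c) (*-mono-≤ (<⇒≤ (log-upper r)) (^-monoˡ-≤ e (n≤2^n L))) ⟩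
      2 ^ c * (2 ^ suc L * (2 ^ L) ^ e)       ≡⟨ cong (λ z → 2 ^ c * (2 ^ suc L * z)) (^-*-assoc 2 L e) ⟩
      2 ^ c * (2 ^ suc L * 2 ^ (L * e))       ≡⟨ cong (2 ^ c *_) (^-distribˡ-+-* 2 (suc L) (L * e)) ⟨
      2 ^ c * 2 ^ (suc L + L * e)             ≡⟨ ^-distribˡ-+-* 2 c _ ⟨
      2 ^ (c + (suc L + L * e))               ≤⟨ ^-monoʳ-≤ 2 (+-monoʳ-≤ c (≤-trans (+-monoˡ-≤ (L * e) (+-monoˡ-≤ L 1≤L)) (≤-reflexive (regroup L e)))) ⟩
      2 ^ D                                   ∎
      where
      open ≤-Reasoning
      regroup : ∀ L e → L + L + L * e ≡ (2 + e) * L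
      regroup = solve-∀
    dense : K * D ^ e ≤ 2 ^ c * L ^ e
    dense = begin
      K * D ^ e                        ≤⟨ *-monoʳ-≤ K (^-monoˡ-≤ e (≤-trans (+-monoˡ-≤ _ c≤cL) (≤-reflexive (sym (*-distribʳ-+ L c (2 + e)))))) ⟩
      K * ((c + (2 + e)) * L) ^ e      ≡⟨ cong (K *_) (^-distrib-* (c + (2 + e)) L e) ⟩
      K * ((c + (2 + e)) ^ e * L ^ e)  ≡⟨ *-assoc K _ _ ⟨
      K * (c + (2 + e)) ^ e * L ^ e    ≤⟨ *-monoˡ-≤ (L ^ e) (proj₂ (exp-beats-poly K e)) ⟩
      2 ^ c * L ^ e                    ∎
      where
      open ≤-Reasoning
      c≤cL : c ≤ c * L
      c≤cL = ≤-trans (≤-reflexive (sym (*-identityʳ c))) (*-monoʳ-≤ c 1≤L)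
    mono : AllColouringsMono π r M
    mono col = found (pigeonhole {r} {2 ^ c * L ^ e} (λ t → ∣ colour-class col t ∣) (≤-trans (s≤s z≤n) 2≤r)
      (≤-reflexive (trans (regroup r (2 ^ c) (L ^ e)) (sym (sum-classes col)))))
      where
      regroup : ∀ r a b → r * (a * b) ≡ a * (r * b)
      regroup = solve-∀
      found : (∃ λ t → t < r × 2 ^ c * L ^ e ≤ ∣ colour-class col t ∣) → HasMonoWave π col
      found (t , _ , q) = class-wave⇒mono π col t (forces D 1≤D M≤2^D (colour-class col t) (≤-trans dense q))

-- Lower bound: wave-free sets

-- The sum of the binomial coefficients `l` choose `i` over all `i < k`, by Pascal's rule.
size : ℕ → ℕ → ℕ
size zero    l       = 0
size (suc k) zero    = 1
size (suc k) (suc l) = size k l + size (suc k) l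

1≤size : ∀ k l → 1 ≤ size (suc k) l
1≤size k zero    = ≤-refl
1≤size k (suc l) = ≤-trans (1≤size k l) (m≤n+m _ (size k l))

size-mono : ∀ k q l → size k l ≤ size k (q + l)
size-mono zero    q       l = z≤n
size-mono (suc k) zero    l = ≤-refl
size-mono (suc k) (suc q) l = ≤-trans (size-mono (suc k) q l) (m≤n+m _ (size k (q + l)))

size-+ : ∀ k q l → q * size k l ≤ size (suc k) (q + l)
size-+ k zero    l = z≤n
size-+ k (suc q) l = +-mono-≤ (size-mono k q l) (size-+ k q l)

-- By `size-+`, `q` further levels gain a factor `q` each time the first argument of `size` grows by
-- one.
q^e≤size : ∀ e q → q ^ e ≤ size (suc e) (e * q)
q^e≤size zero    q = ≤-refl
q^e≤size (suc e) q = ≤-trans (*-monoʳ-≤ q (q^e≤size e q)) (size-+ (suc e) q (e * q))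

size≤2^l : ∀ k l → size k l ≤ 2 ^ l
size≤2^l zero    l       = z≤n
size≤2^l (suc k) zero    = ≤-refl
size≤2^l (suc k) (suc l) = +-mono-≤ (size≤2^l k l) (≤-trans (size≤2^l (suc k) l) (≤-reflexive (sym (+-identityʳ _))))

-- The set without w-waves, scaled by N and with its j-th element moved up by o + j:
-- so that its elements run through consecutive residues modulo N.
Free : ∀ {k w} → Valley k w → (l N c o : ℕ) → ℕ → Set
Free none l N c o x = ⊥
Free (left _ val) zero N c o x = x ≡ N * c + o
Free (right _ val) zero N c o x = x ≡ N * c + o
Free V@(left {k} _ val) (suc l) N c o x = Free V l N c o x ⊎ Free val l N (c + 2 * 4 ^ l) (o + size (suc k) l) x
Free V@(right {k} _ val) (suc l) N c o x = Free val l N c o x ⊎ Free V l N (c + 2 * 4 ^ l) (o + size k l) x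

-- The powers of 4 leave room: two blocks of length `N * 4 ^ l`, the second moved up by twice that
-- length, have a gap of the same length between them and still fit into one block of the next
-- level.
Block : (N c l x : ℕ) → Set
Block N c l x = N * c ≤ x × x < N * c + N * 4 ^ l

Block-point : ∀ {N c o} → o + 1 ≤ N → Block N c 0 (N * c + o)
Block-point {N} {c} {o} h = m≤m+n _ o , +-monoʳ-< (N * c) (≤-trans (≤-reflexive (+-comm 1 o)) (≤-trans h (≤-reflexive (sym (*-identityʳ N)))))

Block-low : ∀ {N c l x} → Block N c l x → Block N c (suc l) x
Block-low {N} {c} {l} (lo , hi) = lo , <-≤-trans hi (+-monoʳ-≤ (N * c) (*-monoʳ-≤ N (m≤m+n (4 ^ l) _)))

Block-high : ∀ {N c l x} → Block N (c + 2 * 4 ^ l) l x → Block N c (suc l) x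
Block-high {N} {c} {l} (lo , hi) =
  ≤-trans (*-monoʳ-≤ N (m≤m+n c _)) lo ,
  <-≤-trans hi (≤-trans (m≤m+n _ (N * 4 ^ l)) (≤-reflexive (eq N c (4 ^ l))))
  where
  eq : ∀ N c v → N * (c + 2 * v) + N * v + N * v ≡ N * c + N * (4 * v)
  eq = solve-∀

module _ {N : ℕ} (o k l : ℕ) (fit : o + size (suc k) (suc l) ≤ N) where

  fit-high : o + size k l + size (suc k) l ≤ N
  fit-high = ≤-trans (≤-reflexive (+-assoc o (size k l) _)) fit

  fit-high′ : o + size (suc k) l + size k l ≤ N
  fit-high′ = ≤-trans (≤-reflexive (trans (+-assoc o _ (size k l)) (cong (o +_) (+-comm _ (size k l))))) fit

  fit-low : o + size k l ≤ N
  fit-low = ≤-trans (m≤m+n _ (size (suc k) l)) fit-high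

  fit-low′ : o + size (suc k) l ≤ N
  fit-low′ = ≤-trans (m≤m+n _ (size k l)) fit-high′

Free-Block : ∀ {k w N c o x} (V : Valley k w) l → o + size k l ≤ N → Free V l N c o x → Block N c l x
Free-Block (left _ val) zero fit refl  = Block-point fit
Free-Block (right _ val) zero fit refl = Block-point fit
Free-Block {N = N} {c} {o} V@(left {k} _ val) (suc l) fit (inj₁ p) =
  Block-low {N} {c} {l} (Free-Block V l (fit-low′ o k l fit) p)
Free-Block {N = N} {c} {o} V@(left {k} _ val) (suc l) fit (inj₂ p) =
  Block-high {N} {c} {l} (Free-Block val l (fit-high′ o k l fit) p)
Free-Block {N = N} {c} {o} V@(right {k} _ val) (suc l) fit (inj₁ p) =
  Block-low {N} {c} {l} (Free-Block val l (fit-low o k l fit) p)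
Free-Block {N = N} {c} {o} V@(right {k} _ val) (suc l) fit (inj₂ p) =
  Block-high {N} {c} {l} (Free-Block V l (fit-high o k l fit) p)

-- Waves in a union of two distant blocks

data Cut (X Y : ℕ → Set) (a : ℕ) (zs : List (ℕ × ℕ)) (b : ℕ) : Set where
  below  : Path X a zs b → Cut X Y a zs b
  above  : Path Y a zs b → Cut X Y a zs b
  across : ∀ {zs₁ r g zs₂ a′ c} → zs ≡ zs₁ ++ (r , g) ∷ zs₂ → Path X a zs₁ a′ → a′ + g ≡ c → Path Y c zs₂ b → Cut X Y a zs b

cut : ∀ {X Y : ℕ → Set} {a zs b} → (∀ {x y} → X x → Y y → x < y) → Path (λ x → X x ⊎ Y x) a zs b → Cut X Y a zs b
cut sep (stop (inj₁ p)) = below (stop p)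
cut sep (stop (inj₂ p)) = above (stop p)
cut sep (step p h e ps) with p | cut sep ps
... | inj₁ p′ | below qs          = below (step p′ h e qs)
... | inj₁ p′ | above qs          = across {zs₁ = []} refl (stop p′) e qs
... | inj₁ p′ | across eq qs e′ rs = across (cong (_ ∷_) eq) (step p′ h e qs) e′ rs
... | inj₂ p′ | above qs          = above (step p′ h e qs)
... | inj₂ p′ | below qs          = ⊥-elim (<-asym (sep (path-start qs) p′) (<-≤-trans (m<m+n _ h) (≤-reflexive e)))
... | inj₂ p′ | across _ qs _ _   = ⊥-elim (<-asym (sep (path-start qs) p′) (<-≤-trans (m<m+n _ h) (≤-reflexive e)))

Mono-⊆ : ∀ {zs zs′} → (∀ {z} → z ∈ zs′ → z ∈ zs) → Mono zs → Mono zs′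
Mono-⊆ sub m i j = m (sub i) (sub j)

path-prefix : ∀ {P a b} zs₁ {zs₂} → Path P a (zs₁ ++ zs₂) b → ∃ λ b′ → Path P a zs₁ b′
path-prefix []       ps              = _ , stop (path-start ps)
path-prefix (_ ∷ zs) (step p h e ps) = let b′ , qs = path-prefix zs ps in b′ , step p h e qs

map-∷ʳ⁻ : ∀ (zs : List (ℕ × ℕ)) w {k} → map proj₁ zs ≡ w ++ k ∷ [] → ∃ λ zs₁ → ∃ λ z → zs ≡ zs₁ ++ z ∷ [] × map proj₁ zs₁ ≡ w
map-∷ʳ⁻ [] [] ()
map-∷ʳ⁻ [] (_ ∷ _) ()
map-∷ʳ⁻ (z ∷ []) [] refl = [] , z , refl , refl
map-∷ʳ⁻ (z ∷ _ ∷ _) [] ()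
map-∷ʳ⁻ (z ∷ zs) (x ∷ w) e with ∷-injective e
... | refl , e′ with map-∷ʳ⁻ zs w e′
...   | zs₁ , z′ , refl , refl = z ∷ zs₁ , z′ , refl , refl

last-cases : ∀ us {r vs} w {k : ℕ} → us ++ r ∷ vs ≡ w ++ k ∷ [] → (us ≡ w × vs ≡ []) ⊎ (r ∈ w × k ∈ vs)
last-cases [] [] refl = inj₁ (refl , refl)
last-cases [] (x ∷ w) refl = inj₂ (here refl , ∈-++⁺ʳ w (here refl))
last-cases (_ ∷ []) [] ()
last-cases (_ ∷ _ ∷ _) [] ()
last-cases (u ∷ us) (x ∷ w) e with ∷-injective e
... | refl , e′ with last-cases us w e′
...   | inj₁ (refl , q) = inj₁ (refl , q)
...   | inj₂ (p , q)    = inj₂ (there p , q)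

block-gap : ∀ {P N c l a zs b z} → (∀ {x} → P x → Block N c l x) → Path P a zs b → z ∈ zs → proj₂ z < N * 4 ^ l
block-gap {N = N} {c} bl p i = +-cancelˡ-< (N * c) _ _
  (≤-<-trans (+-monoˡ-≤ _ (proj₁ (bl (path-start p)))) (≤-<-trans (path-gap p i) (proj₂ (bl (path-end p)))))

link-gap : ∀ {N c l a g b} → Block N c l a → a + g ≡ b → Block N (c + 2 * 4 ^ l) l b → N * 4 ^ l < g
link-gap {N} {c} {l} {a} {g} (_ , a<) refl (b≥ , _) = +-cancelˡ-< a _ _
  (<-≤-trans (+-monoˡ-< (N * 4 ^ l) a<) (≤-trans (≤-reflexive (eq N c (4 ^ l))) b≥))
  where
  eq : ∀ N c v → N * c + N * v + N * v ≡ N * (c + 2 * v)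
  eq = solve-∀

block-sep : ∀ {N c l x y} → Block N c l x → Block N (c + 2 * 4 ^ l) l y → x < y
block-sep {N} {c} {l} (_ , x<) (y≥ , _) = <-≤-trans x< (≤-trans (m≤m+n _ (N * 4 ^ l)) (≤-trans (≤-reflexive (eq N c (4 ^ l))) y≥))
  where
  eq : ∀ N c v → N * c + N * v + N * v ≡ N * (c + 2 * v)
  eq = solve-∀

module _ {X Y : ℕ → Set} {N c l : ℕ} (X-block : ∀ {x} → X x → Block N c l x) (Y-block : ∀ {x} → Y x → Block N (c + 2 * 4 ^ l) l x)
  {k : ℕ} {w : List ℕ} (w<k : All (_< k) w) where

  -- The step across is longer than all steps inside a block. If it comes first, the rest is a wave
  -- for `w` in `Y`; if it comes later, the first step has the largest rank `k` and yet is shorter.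
  -- A wave inside `Y` leaves one for `w` when its first step is dropped.
  avoid-left : ¬ Wave X (k ∷ w) → ¬ Wave Y w → ¬ Wave (λ x → X x ⊎ Y x) (k ∷ w)
  avoid-left ¬X ¬Y (a , zs , b , p , e , mono) = go (cut (λ x y → block-sep {N} {c} {l} (X-block x) (Y-block y)) p)
    where
    tail : ∀ {a zs} → Path Y a zs b → map proj₁ zs ≡ k ∷ w → Mono zs → Wave Y w
    tail (step {zs = zs} _ _ _ ps) refl m = _ , zs , b , ps , refl , Mono-⊆ there m
    go : Cut X Y a zs b → ⊥
    go (below qs) = ¬X (a , zs , b , qs , e , mono)
    go (above qs) = ¬Y (tail qs e mono)
    go (across {[]} {zs₂ = zs₂} refl _ _ rs) = ¬Y (_ , zs₂ , b , rs , proj₂ (∷-injective e) , Mono-⊆ there mono)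
    go (across {z ∷ zs₁} {r} {g} {zs₂} refl qs e′ rs) = <-asym (mono {r , g} {z} link-∈ (here refl) r<z)
      (<-trans (block-gap {N = N} {c} {l} X-block qs (here refl)) (link-gap {N} {c} {l} (X-block (path-end qs)) e′ (Y-block (path-start rs))))
      where
      link-∈ : (r , g) ∈ z ∷ zs₁ ++ (r , g) ∷ zs₂
      link-∈ = there (∈-++⁺ʳ zs₁ (here refl))
      r<z : r < proj₁ z
      r<z = subst (r <_) (sym (proj₁ (∷-injective e)))
        (All-lookup w<k (subst (r ∈_) (proj₂ (∷-injective e)) (∈-map⁺ proj₁ (∈-++⁺ʳ zs₁ (here refl)))))

  -- Symmetric: the last step has the largest rank, so a step across can only be the last one.
  avoid-right : ¬ Wave X w → ¬ Wave Y (w ++ k ∷ []) → ¬ Wave (λ x → X x ⊎ Y x) (w ++ k ∷ [])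
  avoid-right ¬X ¬Y (a , zs , b , p , e , mono) = go (cut (λ x y → block-sep {N} {c} {l} (X-block x) (Y-block y)) p)
    where
    go : Cut X Y a zs b → ⊥
    go (above qs) = ¬Y (a , zs , b , qs , e , mono)
    go (below qs) with map-∷ʳ⁻ zs w e
    ... | zs₁ , z , refl , e′ with path-prefix zs₁ qs
    ...   | b′ , rs = ¬X (a , zs₁ , b′ , rs , e′ , Mono-⊆ ∈-++⁺ˡ mono)
    go (across {zs₁} {r} {g} {zs₂} {a′} refl qs e′ rs)
      with last-cases (map proj₁ zs₁) w (trans (sym (map-++ proj₁ zs₁ ((r , g) ∷ zs₂))) e)
    ... | inj₁ (e″ , _) = ¬X (a , zs₁ , a′ , qs , e″ , Mono-⊆ ∈-++⁺ˡ mono)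
    ... | inj₂ (r∈w , k∈) with ∈-map⁻ proj₁ k∈
    ...   | z , z∈ , refl = <-asym (mono {r , g} {z} (∈-++⁺ʳ zs₁ (here refl)) (∈-++⁺ʳ zs₁ (there z∈)) (All-lookup w<k r∈w))
      (<-trans (block-gap {N = N} {c + 2 * 4 ^ l} {l} Y-block rs z∈) (link-gap {N} {c} {l} (X-block (path-end qs)) e′ (Y-block (path-start rs))))

singleton-free : ∀ {y w} → w ≢ [] → ¬ Wave (_≡ y) w
singleton-free ne (_ , [] , _ , _ , e , _) = ne (sym e)
singleton-free ne (a , .(_ ∷ _) , b , step refl 1≤g refl ps , _ , _) = <-irrefl (sym (path-start ps)) (m<m+n a 1≤g)

free : ∀ {k w N c o} (V : Valley k w) l → o + size k l ≤ N → ¬ Wave (Free V l N c o) w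
free none l fit (_ , _ , _ , p , _ , _) = path-start p
free (left _ val) zero fit wave = singleton-free (λ ()) wave
free (right {w = w} _ val) zero fit wave = singleton-free (nonempty w) wave
  where
  nonempty : ∀ w {k : ℕ} → w ++ k ∷ [] ≢ []
  nonempty []      ()
  nonempty (_ ∷ _) ()
free {N = N} {c} {o} V@(left {k} w<k val) (suc l) fit = avoid-left {N = N} {c} {l}
  (Free-Block {N = N} {c} {o} V l fitX) (Free-Block {N = N} {c + 2 * 4 ^ l} {o + size (suc k) l} val l fitY) w<k
  (free V l fitX) (free val l fitY)
  where
  fitX : o + size (suc k) l ≤ N
  fitX = fit-low′ o k l fit
  fitY : o + size (suc k) l + size k l ≤ N
  fitY = fit-high′ o k l fit
free {N = N} {c} {o} V@(right {k} w<k val) (suc l) fit = avoid-right {N = N} {c} {l}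
  (Free-Block {N = N} {c} {o} val l fitX) (Free-Block {N = N} {c + 2 * 4 ^ l} {o + size k l} V l fitY) w<k
  (free val l fitX) (free V l fitY)
  where
  fitX : o + size k l ≤ N
  fitX = fit-low o k l fit
  fitY : o + size k l + size (suc k) l ≤ N
  fitY = fit-high o k l fit

-- Positions in units of `N`, before the displacement by `o + j`. Arguments `j` beyond the size also
-- get a value below `4 ^ l`, so that `offset-<` needs no condition.
offset : ∀ {k w} → Valley k w → ℕ → ℕ → ℕ
offset none l j = 0
offset (left _ val) zero j = 0
offset (right _ val) zero j = 0
offset V@(left {k} _ val) (suc l) j with j <? size (suc k) l
... | yes _ = offset V l j
... | no  _ = 2 * 4 ^ l + offset val l (j ∸ size (suc k) l)
offset V@(right {k} _ val) (suc l) j with j <? size k l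
... | yes _ = offset val l j
... | no  _ = 2 * 4 ^ l + offset V l (j ∸ size k l)

offset-< : ∀ {k w} (V : Valley k w) l j → offset V l j < 4 ^ l
offset-< none l j = >-nonZero⁻¹ (4 ^ l) {{m^n≢0 4 l}}
offset-< (left _ val) zero j = s≤s z≤n
offset-< (right _ val) zero j = s≤s z≤n
offset-< V@(left {k} _ val) (suc l) j with j <? size (suc k) l
... | yes _ = <-≤-trans (offset-< V l j) (m≤m+n (4 ^ l) _)
... | no  _ = <-≤-trans (+-monoʳ-< (2 * 4 ^ l) (offset-< val l _)) (≤-trans (m≤m+n _ (4 ^ l)) (≤-reflexive (eq (4 ^ l))))
  where
  eq : ∀ v → 2 * v + v + v ≡ 4 * v
  eq = solve-∀
offset-< V@(right {k} _ val) (suc l) j with j <? size k l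
... | yes _ = <-≤-trans (offset-< val l j) (m≤m+n (4 ^ l) _)
... | no  _ = <-≤-trans (+-monoʳ-< (2 * 4 ^ l) (offset-< V l _)) (≤-trans (m≤m+n _ (4 ^ l)) (≤-reflexive (eq (4 ^ l))))
  where
  eq : ∀ v → 2 * v + v + v ≡ 4 * v
  eq = solve-∀

offset-shift : ∀ N c o v a {s j} → s ≤ j → N * (c + v + a) + (o + s + (j ∸ s)) ≡ N * (c + (v + a)) + (o + j)
offset-shift N c o v a {s} s≤j = cong₂ (λ x y → N * x + y) (+-assoc c v a) (trans (+-assoc o s _) (cong (o +_) (m+[n∸m]≡n s≤j)))

∸-bound : ∀ {j a b} → a ≤ j → j < a + b → j ∸ a < b
∸-bound {j} {a} {b} h lt = +-cancelˡ-< a _ _ (≤-<-trans (≤-reflexive (m+[n∸m]≡n h)) lt)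

-- The `j`-th element is congruent to `o + j` modulo `N`: if `o` is 0 and `N` is the size of the
-- set, every residue occurs, which makes the tiling by translates possible.
offset-Free : ∀ {k w} (V : Valley k w) l N c o j → j < size k l → Free V l N c o (N * (c + offset V l j) + (o + j))
offset-Free (left _ val) zero N c o zero h = cong₂ (λ x y → N * x + y) (+-identityʳ c) (+-identityʳ o)
offset-Free (right _ val) zero N c o zero h = cong₂ (λ x y → N * x + y) (+-identityʳ c) (+-identityʳ o)
offset-Free (left _ val) zero N c o (suc j) (s≤s ())
offset-Free (right _ val) zero N c o (suc j) (s≤s ())
offset-Free V@(left {k} _ val) (suc l) N c o j h with j <? size (suc k) l
... | yes p = inj₁ (offset-Free V l N c o j p)
... | no ¬p = inj₂ (subst (Free val l N (c + 2 * 4 ^ l) (o + size (suc k) l))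
    (offset-shift N c o (2 * 4 ^ l) _ (≮⇒≥ ¬p))
    (offset-Free val l N (c + 2 * 4 ^ l) (o + size (suc k) l) (j ∸ size (suc k) l)
      (∸-bound (≮⇒≥ ¬p) (<-≤-trans h (≤-reflexive (+-comm (size k l) _))))))
offset-Free V@(right {k} _ val) (suc l) N c o j h with j <? size k l
... | yes p = inj₁ (offset-Free val l N c o j p)
... | no ¬p = inj₂ (subst (Free V l N (c + 2 * 4 ^ l) (o + size k l))
    (offset-shift N c o (2 * 4 ^ l) _ (≮⇒≥ ¬p))
    (offset-Free V l N (c + 2 * 4 ^ l) (o + size k l) (j ∸ size k l) (∸-bound (≮⇒≥ ¬p) h)))

-- Lower bound: colourings by translates of a wave-free set

points-path : ∀ {k} {P : ℕ → Set} (g : Fin k → ℕ) (y : Fin (suc k) → ℕ) → (∀ i → y (inject₁ i) < y (Fin.suc i)) →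
  (∀ i → P (y i)) → ∃ λ b → Path P (y Fin.zero) (List.tabulate (λ i → g i , gap y i)) b
points-path {zero}  g y rising mem = _ , stop (mem Fin.zero)
points-path {suc k} g y rising mem =
  map₂ (step (mem Fin.zero) (m<n⇒0<n∸m (rising Fin.zero)) (m+[n∸m]≡n (<⇒≤ (rising Fin.zero))))
    (points-path (g ∘ Fin.suc) (y ∘ Fin.suc) (rising ∘ Fin.suc) (mem ∘ Fin.suc))

points-wave : ∀ {k} {P : ℕ → Set} (π : Perm k) (y : Fin (suc k) → ℕ) → IsWave π y → (∀ i → P (y i)) → Wave P (word π)
points-wave {k} {P} π y (rising , order) mem = build (points-path (rank π) y rising mem)
  where
  zs : List (ℕ × ℕ)
  zs = List.tabulate (λ i → rank π i , gap y i)
  mono : Mono zs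
  mono {p} {q} p∈ q∈ lt with ∈-tabulate⁻ p∈ | ∈-tabulate⁻ q∈
  ... | i , refl | j , refl = Equivalence.from (order j i) lt
  build : (∃ λ b → Path P (y Fin.zero) zs b) → Wave P (word π)
  build (b , p) = y Fin.zero , zs , b , p , map-tabulate _ proj₁ , mono

IsWave-shift : ∀ {k} (π : Perm k) s (x : Fin (suc k) → ℕ) → IsWave π x → IsWave π (λ i → s + x i)
IsWave-shift π s x (rising , order) = (λ i → +-monoʳ-< s (rising i)) , λ i j →
  subst₂ (λ a b → (a < b) ⇔ (rank π j < rank π i)) (sym (gap≡ j)) (sym (gap≡ i)) (order i j)
  where
  gap≡ : ∀ i → gap (λ i → s + x i) i ≡ gap x i
  gap≡ i = [m+n]∸[m+o]≡n∸o s (x (Fin.suc i)) (x (inject₁ i))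

-- The residue of x modulo N determines the element of the free set that x is a
-- translate of, and the colour determines the translation.
module _ {k : ℕ} (π : Perm (suc k)) (val : Valley (suc k) (word π)) (l : ℕ) where

  N : ℕ
  N = size (suc k) l

  instance
    N≢0 : NonZero N
    N≢0 = >-nonZero (1≤size k l)

  colour : ℕ → ℕ
  colour x = x / N + (4 ^ l ∸ offset val l (x % N))

  -- The shift by `N * 4 ^ l` makes up for the summand `4 ^ l` in `colour`, which keeps the
  -- translation from becoming negative; waves are invariant under it by `IsWave-shift`.
  colour-Free : ∀ x → Free val l N (colour x) 0 (N * 4 ^ l + x)
  colour-Free x = subst (Free val l N (colour x) 0) decompose
    (offset-Free val l N (colour x) 0 (x % N) (m%n<n x N))
    where
    a : ℕ
    a = offset val l (x % N)
    decompose : N * (colour x + a) + (x % N) ≡ N * 4 ^ l + x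
    decompose = begin
      N * (x / N + (4 ^ l ∸ a) + a) + x % N     ≡⟨ cong (λ z → N * z + x % N) (trans (+-assoc (x / N) _ a) (cong (x / N +_) (m∸n+n≡m (<⇒≤ (offset-< val l (x % N)))))) ⟩
      N * (x / N + 4 ^ l) + x % N               ≡⟨ regroup N (x / N) (4 ^ l) (x % N) ⟩
      N * 4 ^ l + (x % N + x / N * N)           ≡⟨ cong (N * 4 ^ l +_) (m≡m%n+[m/n]*n x N) ⟨
      N * 4 ^ l + x                             ∎
      where
      open ≡-Reasoning
      regroup : ∀ N q v r → N * (q + v) + r ≡ N * v + (r + q * N)
      regroup = solve-∀

  -- The quotient `x / N` is less than `Q` and the offset contributes at most `4 ^ l` more, so
  -- `Q + 4 ^ l` colours suffice. Each colour class lies in a single translate of the free set.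
  wave-free-colouring : ∀ {M Q r} → M ≤ Q * N → Q + 4 ^ l ≤ r → Σ (Fin M → Fin r) λ c → ¬ HasMonoWave π c
  wave-free-colouring {M} {Q} {r} M≤ r≥ = c , no-wave
    where
    colour-< : ∀ x → x < M → colour x < r
    colour-< x x<M = <-≤-trans (+-mono-<-≤ (m<n*o⇒m/o<n (<-≤-trans x<M M≤)) (m∸n≤m (4 ^ l) (offset val l (x % N)))) r≥
    c : Fin M → Fin r
    c i = fromℕ< (colour-< (toℕ i) (toℕ<n i))
    no-wave : ¬ HasMonoWave π c
    no-wave (x , wave , same) = free {o = 0} val l ≤-refl
      (points-wave π (λ i → N * 4 ^ l + toℕ (x i)) (IsWave-shift π (N * 4 ^ l) (toℕ ∘ x) wave)
        (λ i → subst (λ z → Free val l N z 0 (N * 4 ^ l + toℕ (x i))) (colour≡ i) (colour-Free (toℕ (x i)))))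
      where
      colour≡ : ∀ i → colour (toℕ (x i)) ≡ colour (toℕ (x Fin.zero))
      colour≡ i = trans (sym (toℕ-fromℕ< _)) (trans (cong toℕ (same i)) (toℕ-fromℕ< _))

-- Lower bounds for `g` and `P`

module _ {e : ℕ} (π : Perm (suc e)) (val : Valley (suc e) (word π)) where

  -- Large enough that for `l = e * q` and `1 ≤ q` both `size (suc e) l * 4 ^ l` and `2 * 4 ^ l` are
  -- at most `2 ^ (B * q)`.
  B : ℕ
  B = 4 * suc e

  scale : ∀ n → 2 ^ B ≤ n → ∃ λ q → 1 ≤ q × B * q ≤ ⌊log₂ n ⌋ × ⌊log₂ n ⌋ ^ e ≤ (2 * B) ^ e * size (suc e) (e * q)
  scale n n≥ = q , 1≤q , B*q≤L , (begin
    L ^ e                                  ≤⟨ ^-monoˡ-≤ e L≤ ⟩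
    (2 * B * q) ^ e                        ≡⟨ ^-distrib-* (2 * B) q e ⟩
    (2 * B) ^ e * q ^ e                    ≤⟨ *-monoʳ-≤ ((2 * B) ^ e) (q^e≤size e q) ⟩
    (2 * B) ^ e * size (suc e) (e * q)     ∎)
    where
    open ≤-Reasoning
    L q : ℕ
    L = ⌊log₂ n ⌋
    q = L / B
    B≤L : B ≤ L
    B≤L = ≤-trans (≤-reflexive (sym (⌊log₂[2^n]⌋≡n B))) (⌊log₂⌋-mono-≤ n≥)
    L<B+qB : L < B + q * B
    L<B+qB = ≤-<-trans (≤-reflexive (m≡m%n+[m/n]*n L B)) (+-monoˡ-< (q * B) (m%n<n L B))
    1≤q : 1 ≤ q
    1≤q with 1 ≤? q
    ... | yes h = h
    ... | no ¬h = ⊥-elim (<-irrefl refl (<-≤-trans L<B+qB (≤-trans (≤-reflexive (trans (cong (λ z → B + z * B) (n<1⇒n≡0 (≰⇒> ¬h))) (+-identityʳ B))) B≤L)))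
    B*q≤L : B * q ≤ L
    B*q≤L = ≤-trans (≤-reflexive (*-comm B q)) (≤-trans (m≤n+m (q * B) (L % B)) (≤-reflexive (sym (m≡m%n+[m/n]*n L B))))
    -- Rounding down to `q` loses at most a factor 2, as `q` is at least 1.
    L≤ : L ≤ 2 * B * q
    L≤ = ≤-trans (<⇒≤ L<B+qB) (≤-trans (+-monoˡ-≤ (q * B) (≤-trans (≤-reflexive (sym (*-identityʳ B))) (*-monoʳ-≤ B 1≤q)))
      (≤-reflexive (double B q)))
      where
      double : ∀ B q → B * q + q * B ≡ 2 * B * q
      double = solve-∀

  -- Every colour class is free of waves, hence has at most `h` elements; this bounds `g` from below
  -- by means of a colouring.
  classes-bound : ∀ {n r h} → IsG π n h → (c : Fin n → Fin r) → ¬ HasMonoWave π c → n ≤ r * h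
  classes-bound {n} {r} {h} (_ , max) c no-wave = begin
    n                                           ≡⟨ sum-classes c ⟨
    sum< r (λ t → ∣ colour-class c t ∣)         ≤⟨ sum<-mono r (λ t → max (colour-class c t) (no-wave ∘ class-wave⇒mono π c t)) ⟩
    sum< r (λ _ → h)                            ≡⟨ sum<-const r h ⟩
    r * h                                       ∎
    where open ≤-Reasoning

  4^l≡2^2l : ∀ l → 4 ^ l ≡ 2 ^ (2 * l)
  4^l≡2^2l l = ^-*-assoc 2 2 l

  -- A colouring with `r = Q + 4 ^ l` colours gives `n ≤ r * h`. Moreover `S * r ≤ 3 * n`, with one
  -- `n` each for the rounding in `Q`, for the quotients and for the translations; hence
  -- `S ≤ 3 * h`.
  valley⇒Ω-g : BigΩ (IsG π) (logPow e)
  valley⇒Ω-g = (2 * B) ^ e * 3 , 2 ^ B , bound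
    where
    bound : ∀ n → 2 ^ B ≤ n → ∀ h → IsG π n h → logPow e n ≤ (2 * B) ^ e * 3 * h
    bound n n≥ h isG = go (scale n n≥)
      where
      go : (∃ λ q → 1 ≤ q × B * q ≤ ⌊log₂ n ⌋ × ⌊log₂ n ⌋ ^ e ≤ (2 * B) ^ e * size (suc e) (e * q)) →
        logPow e n ≤ (2 * B) ^ e * 3 * h
      go (q , 1≤q , Bq≤L , dense) = ≤-trans dense (≤-trans (*-monoʳ-≤ ((2 * B) ^ e) S≤3h) (≤-reflexive (sym (*-assoc ((2 * B) ^ e) 3 h))))
        where
        l S Q r : ℕ
        l = e * q
        S = size (suc e) l
        instance
          S≢0 : NonZero S
          S≢0 = >-nonZero (1≤size e l)
        Q = suc (n / S)
        r = Q + 4 ^ l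
        1≤n : 1 ≤ n
        1≤n = ≤-trans (1≤pow B (s≤s {0} {1} z≤n)) n≥
        S4^l≤n : S * 4 ^ l ≤ n
        S4^l≤n = begin
          S * 4 ^ l                ≤⟨ *-monoˡ-≤ (4 ^ l) (size≤2^l (suc e) l) ⟩
          2 ^ l * 4 ^ l            ≡⟨ cong (2 ^ l *_) (4^l≡2^2l l) ⟩
          2 ^ l * 2 ^ (2 * l)      ≡⟨ ^-distribˡ-+-* 2 l (2 * l) ⟨
          2 ^ (l + 2 * l)          ≤⟨ ^-monoʳ-≤ 2 (≤-trans (m≤m+n (l + 2 * l) (e * q + 4 * q)) (≤-trans (≤-reflexive (regroup e q)) Bq≤L)) ⟩
          2 ^ ⌊log₂ n ⌋            ≤⟨ log-lower 1≤n ⟩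
          n                        ∎
          where
          open ≤-Reasoning
          regroup : ∀ e q → e * q + 2 * (e * q) + (e * q + 4 * q) ≡ 4 * suc e * q
          regroup = solve-∀
        S≤n : S ≤ n
        S≤n = ≤-trans (≤-trans (≤-reflexive (sym (*-identityʳ S))) (*-monoʳ-≤ S (1≤pow l (s≤s {0} {3} z≤n)))) S4^l≤n
        n≤QS : n ≤ Q * S
        n≤QS = ≤-trans (≤-reflexive (m≡m%n+[m/n]*n n S)) (+-monoˡ-≤ (n / S * S) (<⇒≤ (m%n<n n S)))
        n≤rh : n ≤ r * h
        n≤rh = apply (wave-free-colouring π val l {n} {Q} {r} n≤QS ≤-refl)
          where
          apply : (Σ (Fin n → Fin r) λ c → ¬ HasMonoWave π c) → n ≤ r * h
          apply (c , ok) = classes-bound isG c ok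
        Sr≤3n : S * r ≤ 3 * n
        Sr≤3n = begin
          S * (suc (n / S) + 4 ^ l)          ≡⟨ regroup S (n / S) (4 ^ l) ⟩
          S + (n / S * S + S * 4 ^ l)        ≤⟨ +-mono-≤ S≤n (+-mono-≤ (≤-trans (m≤n+m _ (n % S)) (≤-reflexive (sym (m≡m%n+[m/n]*n n S)))) S4^l≤n) ⟩
          n + (n + n)                        ≡⟨ triple n ⟩
          3 * n                              ∎
          where
          open ≤-Reasoning
          regroup : ∀ S q v → S * (suc q + v) ≡ S + (q * S + S * v)
          regroup = solve-∀
          triple : ∀ n → n + (n + n) ≡ 3 * n
          triple = solve-∀
        S≤3h : S ≤ 3 * h
        S≤3h = *-cancelˡ-≤ n {{>-nonZero 1≤n}} (begin
          n * S              ≤⟨ *-monoˡ-≤ S n≤rh ⟩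
          r * h * S          ≡⟨ regroup r h S ⟩
          S * r * h          ≤⟨ *-monoˡ-≤ h Sr≤3n ⟩
          3 * n * h          ≡⟨ regroup′ n h ⟩
          n * (3 * h)        ∎)
          where
          open ≤-Reasoning
          regroup : ∀ r h S → r * h * S ≡ S * r * h
          regroup = solve-∀
          regroup′ : ∀ n h → 3 * n * h ≡ n * (3 * h)
          regroup′ = solve-∀

  -- Half of the colours, `Q`, serve the quotients, and at least `4 ^ l` remain for the
  -- translations; so up to `Q * S` points can be coloured without a monochromatic wave.
  valley⇒Ω-P : BigΩ (IsP π) (rLogPow e)
  valley⇒Ω-P = (2 * B) ^ e * 3 , 2 ^ B , bound
    where
    bound : ∀ r → 2 ^ B ≤ r → ∀ h → IsP π r h → rLogPow e r ≤ (2 * B) ^ e * 3 * h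
    bound r r≥ h (_ , forced , _) = go (scale r r≥)
      where
      go : (∃ λ q → 1 ≤ q × B * q ≤ ⌊log₂ r ⌋ × ⌊log₂ r ⌋ ^ e ≤ (2 * B) ^ e * size (suc e) (e * q)) →
        rLogPow e r ≤ (2 * B) ^ e * 3 * h
      go (q , 1≤q , Bq≤L , dense) = begin
        r * ⌊log₂ r ⌋ ^ e                  ≤⟨ *-mono-≤ r≤3Q dense ⟩
        3 * Q * ((2 * B) ^ e * S)          ≡⟨ regroup Q ((2 * B) ^ e) S ⟩
        (2 * B) ^ e * 3 * (Q * S)          ≤⟨ *-monoʳ-≤ ((2 * B) ^ e * 3) QS≤h ⟩
        (2 * B) ^ e * 3 * h                ∎
        where
        open ≤-Reasoning
        l S Q : ℕ
        l = e * q
        S = size (suc e) l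
        Q = r / 2
        regroup : ∀ Q b S → 3 * Q * (b * S) ≡ b * 3 * (Q * S)
        regroup = solve-∀
        1≤r : 1 ≤ r
        1≤r = ≤-trans (1≤pow B (s≤s {0} {1} z≤n)) r≥
        2·4^l≤r : 2 * 4 ^ l ≤ r
        2·4^l≤r = begin
          2 * 4 ^ l                ≡⟨ cong (2 *_) (4^l≡2^2l l) ⟩
          2 ^ suc (2 * l)          ≤⟨ ^-monoʳ-≤ 2 (≤-trans (+-monoˡ-≤ (2 * l) 1≤q) (≤-trans (m≤m+n _ (2 * (e * q) + 3 * q)) (≤-trans (≤-reflexive (regroup′ e q)) Bq≤L))) ⟩
          2 ^ ⌊log₂ r ⌋            ≤⟨ log-lower 1≤r ⟩
          r                        ∎
          where
          regroup′ : ∀ e q → q + 2 * (e * q) + (2 * (e * q) + 3 * q) ≡ 4 * suc e * q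
          regroup′ = solve-∀
        Q2≤r : Q * 2 ≤ r
        Q2≤r = ≤-trans (m≤n+m _ (r % 2)) (≤-reflexive (sym (m≡m%n+[m/n]*n r 2)))
        colours : Q + 4 ^ l ≤ r
        colours = *-cancelˡ-≤ 2 (≤-trans (≤-reflexive (regroup″ Q (4 ^ l))) (≤-trans (+-mono-≤ Q2≤r 2·4^l≤r) (≤-reflexive (cong (r +_) (sym (+-identityʳ r))))))
          where
          regroup″ : ∀ Q v → 2 * (Q + v) ≡ Q * 2 + 2 * v
          regroup″ = solve-∀
        r≤1+2Q : r ≤ 1 + Q * 2
        r≤1+2Q = ≤-trans (≤-reflexive (m≡m%n+[m/n]*n r 2)) (+-monoˡ-≤ (Q * 2) (s≤s⁻¹ (m%n<n r 2)))
        1≤Q : 1 ≤ Q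
        1≤Q with 1 ≤? Q
        ... | yes p = p
        ... | no ¬p = ⊥-elim (<-irrefl refl (<-≤-trans (+-mono-≤ {1} {4 ^ l} {1} {4 ^ l} (1≤pow l (s≤s {0} {3} z≤n)) (1≤pow l (s≤s {0} {3} z≤n)))
            (≤-trans (≤-reflexive (cong (4 ^ l +_) (sym (+-identityʳ (4 ^ l))))) (≤-trans 2·4^l≤r (≤-trans r≤1+2Q (≤-reflexive (cong (λ z → 1 + z * 2) (n<1⇒n≡0 (≰⇒> ¬p)))))))))
        r≤3Q : r ≤ 3 * Q
        r≤3Q = ≤-trans r≤1+2Q (≤-trans (+-monoˡ-≤ (Q * 2) 1≤Q) (≤-reflexive (regroup‴ Q)))
          where
          regroup‴ : ∀ Q → Q + Q * 2 ≡ 3 * Q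
          regroup‴ = solve-∀
        QS≤h : Q * S ≤ h
        QS≤h with h ≤? Q * S
        ... | no ¬p = <⇒≤ (≰⇒> ¬p)
        ... | yes p = ⊥-elim (refute (wave-free-colouring π val l {h} {Q} {r} p colours))
          where
          refute : (Σ (Fin h → Fin r) λ c → ¬ HasMonoWave π c) → ⊥
          refute (c , ok) = ok (forced c)

theorem1p14 : (k : ℕ) → 1 ≤ k → (π : Perm k) →
    (¬ HasPeak π →
    BigΘ (IsG π) (logPow (k ∸ 1)) × BigΘ (IsP π) (rLogPow (k ∸ 1))) ×
    (HasPeak π →
    BigO (IsG π) (logPow (k ∸ 2)) × BigO (IsP π) (rLogPow (k ∸ 2)))
theorem1p14 (suc k) _ π = unimodal , peaked
  where
  unimodal : ¬ HasPeak π → BigΘ (IsG π) (logPow k) × BigΘ (IsP π) (rLogPow k)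
  unimodal ¬peak = (forces⇒O-g {e = k} π forces , valley⇒Ω-g π val) , (forces⇒O-P {e = k} π forces , valley⇒Ω-P π val)
    where
    val : Valley (suc k) (word π)
    val = no-peak-valley π ¬peak
    forces : Forces k π
    forces = hits⇒forces {e = k} π (valley-hits val)
  peaked : HasPeak π → BigO (IsG π) (logPow (suc k ∸ 2)) × BigO (IsP π) (rLogPow (suc k ∸ 2))
  peaked peak = forces⇒O-g {e = suc k ∸ 2} π forces , forces⇒O-P {e = suc k ∸ 2} π forces
    where
    forces : Forces (suc k ∸ 2) π
    forces = hits⇒forces {e = suc k ∸ 2} π (peak-hits π peak)
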